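{- For every integer $d\ge 2$ and every constant $C>0$ there is a constant $c>0$ such that for infinitely many positive integers $n$ there exist an $n$-vertex directed unweighted graph $G=(V,E)$ with $m=|E|$ edges and a set $S\subseteq V$ with $|S|=\widetilde{\Theta}(n^{3/(d+3)})$ such that for every shortcut set $H$ of $G$ with $|H|\le Cn$, and also for every shortcut set $H$ of $G$ with $|H|\le Cm$, the sourcewise diameter of $G\cup H$ with respect to $S$ is at least $c\,n^{1/(d+3)}$.
   Context: For a directed graph $G=(V,E)$, a shortcut set is a set $H$ of ordered pairs $(u,v)$ of distinct vertices such that $v$ is reachable from $u$ in $G$; $G\cup H$ denotes $(V,E\cup H)$. For $S\subseteq V$, the sourcewise diameter of a directed graph with respect to $S$ is $\max\mathrm{dist}(s,v)$ over all $(s,v)\in S\times V$ with $v$ reachable from $s$, where $\mathrm{dist}$ is the unweighted shortest-path distance. $|S|=\widetilde{\Theta}(n^{3/(d+3)})$ means $|S|$ lies between $n^{3/(d+3)}/\mathrm{polylog}(n)$ and $n^{3/(d+3)}\cdot\mathrm{polylog}(n)$. -}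

module Defs where

open import Data.Nat using (ℕ; zero; suc; _+_; _*_; _^_; _≤_)
open import Data.Nat.Logarithm using (⌊log₂_⌋)
open import Data.Integer using (+_)
open import Data.Rational using (ℚ; _/_; 1ℚ) renaming (_*_ to _*ℚ_)
open import Data.Fin using (Fin)
open import Data.Product using (_×_; _,_; ∃; ∃-syntax; Σ-syntax)
open import Data.List using (List; length; _++_)
open import Data.List.Membership.Propositional using (_∈_)
open import Data.List.Relation.Unary.All using (All)
open import Data.List.Relation.Unary.Unique.Propositional using (Unique)
open import Relation.Binary.PropositionalEquality using (_≢_)

⟦_⟧ : ℕ → ℚ
⟦ n ⟧ = (+ n) / 1

_^ℚ_ : ℚ → ℕ → ℚ
q ^ℚ zero = 1ℚ
q ^ℚ suc k = q *ℚ (q ^ℚ k)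

EdgeList : ℕ → Set
EdgeList n = List (Fin n × Fin n)

IsDigraph : ∀ {n} → EdgeList n → Set
IsDigraph E = Unique E × All (λ e → let (u , v) = e in u ≢ v) E

data Walk {n : ℕ} (E : EdgeList n) : Fin n → Fin n → ℕ → Set where
  here : ∀ {u} → Walk E u u 0
  step : ∀ {u w v k} → (u , w) ∈ E → Walk E w v k → Walk E u v (suc k)

Reachable : ∀ {n} → EdgeList n → Fin n → Fin n → Set
Reachable E u v = ∃[ k ] Walk E u v k

IsShortcutSet : ∀ {n} → EdgeList n → EdgeList n → Set
IsShortcutSet E H =
  Unique H × All (λ e → let (u , v) = e in (u ≢ v) × Reachable E u v) H

-- "dist_E(s , v) ≥ D" for a rational D ≥ 0 given through D^p:
-- every walk from s to v has length ℓ with (D ^ p) ≤ ℓ ^ p.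
-- SourcewiseDiamAtLeast E S p Dp : the sourcewise diameter of (Fin n , E)
-- w.r.t. S is at least D, where Dp = D ^ p (with D ≥ 0, p ≥ 1), i.e.
-- there are s ∈ S and v reachable from s with dist(s , v) ≥ D.
open import Data.Fin.Subset using (Subset) renaming (_∈_ to _∈ₛ_)
open Data.Rational using () renaming (_≤_ to _≤ℚ_)

SourcewiseDiamAtLeast : ∀ {n} → EdgeList n → Subset n → (p : ℕ) → ℚ → Set
SourcewiseDiamAtLeast {n} E S p Dp =
  Σ[ s ∈ Fin n ] Σ[ v ∈ Fin n ]
    (s ∈ₛ S) × Reachable E s v ×
    (∀ ℓ → Walk E s v ℓ → Dp ≤ℚ (⟦ ℓ ⟧ ^ℚ p))

polylog : ℕ → ℕ → ℕ → ℕ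
polylog K k n = K * (1 + ⌊log₂ n ⌋) ^ k

-- |S| = Θ̃(n^{3/(d+3)}) with hidden polylog K (1+log n)^k, stated after
-- raising to the power (d+3):
--   n^3 ≤ (|S| * polylog)^(d+3)   and   |S|^(d+3) ≤ n^3 * polylog^(d+3)
SizeTildeTheta : (d K k n s : ℕ) → Set
SizeTildeTheta d K k n s =
  (n ^ 3 ≤ (s * polylog K k n) ^ (d + 3)) ×
  (s ^ (d + 3) ≤ n ^ 3 * polylog K k n ^ (d + 3))

{-# OPTIONS --safe #-}
module Submission where

-- A vertex of the layered network carries (x₁, x₂, y); a step at layer p may decrease each xₖ by a
-- bit bₖ and increases y by (b₁ + b₂) λ(p), where λ(p) = 2 r + 1 for the bit reversal r of p.  A pair
-- of thresholds (t₁, t₂) selects the path with bₖ = 1 iff λ(p) < 2 tₖ.  It minimises a linear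
-- potential strictly, hence is the only walk between its ends, and a shortcut is of use to it only
-- if both ends of the shortcut lie on it.  Bit reversal is equidistributed in every window, so two
-- points of a path that are ℓ layers apart determine each threshold up to O(D / ℓ), D being the
-- number of layers; and if the second point is beyond the middle they determine t₂ up to O(1) once
-- the x₂-coordinate of the source is known, which ranges over A widely spaced values that ℓ ≥ 8 A
-- layers tell apart.  So a shortcut of length ℓ serves O(D / ℓ) paths and saves O(D) steps in all.
-- There are A D⁵ paths in a network of O(D⁵) vertices: for A large compared with C, some path keeps
-- a constant fraction of its D steps.  This is the case d = 2; for larger d the sources are joined
-- to D^(d-2) disjoint copies of the network.

open import Defs
open import Algebra.Bundles using (CommutativeMonoid)
open import Data.Fin using (Fin; toℕ; fromℕ<; combine; join; splitAt)
import Data.Fin as Fin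
open import Data.Fin.Properties
  using (toℕ-injective; toℕ-fromℕ<; toℕ<n; fromℕ<-injective; combine-injective; injective⇒≤; splitAt-join; +↔⊎; *↔×)
open import Data.Fin.Subset using (Subset; inside; outside; ∣_∣) renaming (_∈_ to _∈ₛ_)
open import Data.Fin.Subset.Properties using (∣⊤∣≡n; ∣⊥∣≡0)
open import Data.Integer using (+[1+_]) renaming (∣_∣ to ∣_∣ℤ)
import Data.Integer as ℤ
import Data.Integer.Properties as ℤ
open import Data.List using (List; []; _∷_; length; map; filter; lookup; allFin; cartesianProduct; _++_)
open import Data.List.Membership.Propositional using (_∈_)
open import Data.List.Membership.Propositional.Properties
  using (∈-lookup; ∈-filter⁺; ∈-filter⁻; ∈-cartesianProduct⁺; ∈-allFin; ∈-++⁺ˡ; ∈-++⁻)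
open import Data.List.Properties using (length-map; length-tabulate)
import Data.List.Relation.Unary.All as All
open import Data.List.Relation.Unary.AllPairs using (_∷_)
open import Data.List.Relation.Unary.Any using (here; there)
open import Data.List.Relation.Unary.Unique.Propositional using (Unique)
open import Data.List.Relation.Unary.Unique.Propositional.Properties using (filter⁺; map⁺; allFin⁺; cartesianProduct⁺)
open import Data.Nat
open import Data.Nat.DivMod
  using (m≡m%n+[m/n]*n; m%n<n; m/n*n≤m; m<n*o⇒m/o<n; [m+kn]%n≡m%n; m<n⇒m%n≡m; m*n/n≡m; m<n⇒m/n≡0; +-distrib-/-∣ʳ)
open import Data.Nat.Divisibility using (n∣m*n)
open import Data.Nat.ListAction using (sum)
open import Data.Nat.Properties
open import Data.Nat.Tactic.RingSolver using (solve-∀)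
open import Data.Product using (_×_; _,_; ∃-syntax; Σ-syntax; proj₁; proj₂)
open import Data.Product.Function.NonDependent.Propositional using (_×-↔_)
open import Data.Rational using (ℚ; mkℚ; Positive; NonNegative; 1ℚ; 1/_; ↥_; toℚᵘ)
  renaming (_≤_ to _≤ℚ_; _*_ to _*ℚ_; NonZero to NonZeroℚ)
import Data.Rational.Properties as ℚ
open import Data.Rational.Unnormalised using (mkℚᵘ; *≤*; _≃_)
import Data.Rational.Unnormalised as ℚᵘ
import Data.Rational.Unnormalised.Properties as ℚᵘ
open import Data.Sum using (_⊎_; inj₁; inj₂)
open import Data.Sum.Function.Propositional using (_⊎-↔_)
open import Data.Sum.Properties using (inj₁-injective; inj₂-injective)
open import Data.Unit using (⊤; tt)
open import Data.Empty using (⊥)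
open import Data.Vec using (Vec; replicate) renaming (_++_ to _++ᵛ_)
open import Data.Vec.Properties using (lookup-++ˡ; lookup-replicate; lookup⇒[]=)
open import Function using (_∘_)
open import Function.Bundles using (_↔_; module Inverse; module Injection)
open import Function.Properties.Inverse using (↔⇒↣; ↔-trans; ↔-refl)
open import Relation.Nullary using (Dec; yes; no; ¬_; contradiction)
open import Relation.Nullary.Decidable using (_×-dec_; map′)
open import Relation.Binary.PropositionalEquality
  using (_≡_; refl; sym; trans; cong; cong₂; subst; subst₂; module ≡-Reasoning)
import Algebra.Properties.CommutativeSemigroup *-commutativeSemigroup as *-CS
import Algebra.Properties.CommutativeSemigroup (CommutativeMonoid.commutativeSemigroup ℚ.*-1-commutativeMonoid) as ℚ-CS

-- Indicators and prefix sums

⟨_⟩ : ∀ {a} {P : Set a} → Dec P → ℕ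
⟨ yes _ ⟩ = 1
⟨ no _ ⟩ = 0

⟨⟩≡1 : ∀ {a} {P : Set a} (p : Dec P) → P → ⟨ p ⟩ ≡ 1
⟨⟩≡1 (yes _) _ = refl
⟨⟩≡1 (no ¬p) p = contradiction p ¬p

⟨⟩≡0 : ∀ {a} {P : Set a} (p : Dec P) → ¬ P → ⟨ p ⟩ ≡ 0
⟨⟩≡0 (yes p) ¬p = contradiction p ¬p
⟨⟩≡0 (no _) _ = refl

⟨⟩≤1 : ∀ {a} {P : Set a} (p : Dec P) → ⟨ p ⟩ ≤ 1
⟨⟩≤1 (yes _) = ≤-refl
⟨⟩≤1 (no _) = z≤n

prefix : (ℕ → ℕ) → ℕ → ℕ
prefix f zero = 0
prefix f (suc i) = prefix f i + f i

prefix-mono : ∀ f {i j} → i ≤ j → prefix f i ≤ prefix f j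
prefix-mono f {i} {zero} z≤n = ≤-refl
prefix-mono f {i} {suc j} i≤1+j with m≤n⇒m<n∨m≡n i≤1+j
... | inj₁ (s≤s i≤j) = ≤-trans (prefix-mono f i≤j) (m≤m+n _ _)
... | inj₂ refl = ≤-refl

prefix-≤ : ∀ {f c} → (∀ p → f p ≤ c) → ∀ i → prefix f i ≤ i * c
prefix-≤ f≤c zero = z≤n
prefix-≤ {f} {c} f≤c (suc i) =
  ≤-trans (+-mono-≤ (prefix-≤ f≤c i) (f≤c i)) (≤-reflexive (+-comm (i * c) c))

prefix-subadditive : ∀ {f g h} → (∀ p → f p ≤ g p + h p) →
  ∀ i → prefix f i ≤ prefix g i + prefix h i
prefix-subadditive f≤g+h zero = z≤n
prefix-subadditive {f} {g} {h} f≤g+h (suc i) = begin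
  prefix f i + f i                           ≤⟨ +-mono-≤ (prefix-subadditive f≤g+h i) (f≤g+h i) ⟩
  (prefix g i + prefix h i) + (g i + h i)    ≡⟨ shuffle (prefix g i) (prefix h i) (g i) (h i) ⟩
  (prefix g i + g i) + (prefix h i + h i)    ∎
  where
  open ≤-Reasoning
  shuffle : ∀ a b c d → (a + b) + (c + d) ≡ (a + c) + (b + d)
  shuffle = solve-∀

-- Both sides are moved so that no subtraction occurs.
prefix-window-mono : ∀ {f g} → (∀ p → f p ≤ g p) → ∀ {i j} → i ≤ j →
  prefix f j + prefix g i ≤ prefix f i + prefix g j
prefix-window-mono f≤g {i} {zero} z≤n = ≤-refl
prefix-window-mono {f} {g} f≤g {i} {suc j} i≤1+j with m≤n⇒m<n∨m≡n i≤1+j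
... | inj₂ refl = ≤-refl
... | inj₁ (s≤s i≤j) = begin
  (prefix f j + f j) + prefix g i   ≡⟨ swapʳ (prefix f j) (f j) (prefix g i) ⟩
  (prefix f j + prefix g i) + f j   ≤⟨ +-mono-≤ (prefix-window-mono f≤g i≤j) (f≤g j) ⟩
  (prefix f i + prefix g j) + g j   ≡⟨ +-assoc (prefix f i) _ _ ⟩
  prefix f i + (prefix g j + g j)   ∎
  where
  open ≤-Reasoning
  swapʳ : ∀ a b c → (a + b) + c ≡ (a + c) + b
  swapʳ = solve-∀

prefix-window-strict : ∀ {f g} → (∀ p → f p ≤ g p) →
  ∀ {i p j} → i ≤ p → p < j → f p < g p →
  prefix f j + prefix g i < prefix f i + prefix g j
prefix-window-strict {f} {g} f≤g {i} {p} {j} i≤p p<j fp<gp =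
  -- Adding the prefixes up to `suc p` on both sides splits the window there: the left part ends
  -- with the strict layer `p`, and the right part is merely monotone.
  +-cancelˡ-< (prefix f (suc p) + prefix g (suc p)) _ _ (begin-strict
    (f₁ + g₁) + (prefix f j + prefix g i)         ≡⟨ e₁ f₁ g₁ (prefix f j) (prefix g i) ⟩
    (prefix f j + g₁) + (f₁ + prefix g i)         <⟨ +-mono-≤-< (prefix-window-mono f≤g p<j) window ⟩
    (f₁ + prefix g j) + (prefix f i + g₁)         ≡⟨ e₂ f₁ g₁ (prefix f i) (prefix g j) ⟩
    (f₁ + g₁) + (prefix f i + prefix g j)         ∎)
  where
  open ≤-Reasoning
  f₁ = prefix f (suc p)
  g₁ = prefix g (suc p)
  e₁ : ∀ a b c d → (a + b) + (c + d) ≡ (c + b) + (a + d)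
  e₁ = solve-∀
  e₂ : ∀ a b c d → (a + d) + (c + b) ≡ (a + b) + (c + d)
  e₂ = solve-∀
  e₃ : ∀ a b c → (a + b) + c ≡ (a + c) + b
  e₃ = solve-∀
  window : f₁ + prefix g i < prefix f i + g₁
  window = begin-strict
    (prefix f p + f p) + prefix g i   ≡⟨ e₃ (prefix f p) (f p) (prefix g i) ⟩
    (prefix f p + prefix g i) + f p   <⟨ +-mono-≤-< (prefix-window-mono f≤g i≤p) fp<gp ⟩
    (prefix f i + prefix g p) + g p   ≡⟨ +-assoc (prefix f i) _ _ ⟩
    prefix f i + (prefix g p + g p)   ∎

prefix-indicator-≤1 : ∀ {P : ℕ → Set} (P? : ∀ p → Dec (P p)) j →
  (∀ {p q} → p < j → q < j → P p → P q → p ≡ q) → prefix (⟨_⟩ ∘ P?) j ≤ 1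
prefix-indicator-≤1 P? zero _ = z≤n
prefix-indicator-≤1 {P} P? (suc j) unique with P? j
... | no _ = ≤-trans (≤-reflexive (+-identityʳ _))
                     (prefix-indicator-≤1 P? j λ p<j q<j → unique (m<n⇒m<1+n p<j) (m<n⇒m<1+n q<j))
... | yes Pj = ≤-reflexive (cong (_+ 1) (none j ≤-refl))
  where
  none : ∀ i → i ≤ j → prefix (⟨_⟩ ∘ P?) i ≡ 0
  none zero _ = refl
  none (suc i) i<j = cong₂ _+_ (none i (<⇒≤ i<j))
    (⟨⟩≡0 (P? i) λ Pi → <⇒≢ i<j (unique (m<n⇒m<1+n i<j) ≤-refl Pi Pj))

-- Bit reversal

-- The lowest binary digit of the index becomes the highest digit of the value; digits beyond the
-- first `e` are dropped.
rev : ℕ → ℕ → ℕ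
rev zero i = 0
rev (suc e) i = i % 2 * 2 ^ e + rev e (i / 2)

rev-bounded : ∀ e i → rev e i < 2 ^ e
rev-bounded zero i = s≤s z≤n
rev-bounded (suc e) i = begin-strict
  i % 2 * 2 ^ e + rev e (i / 2)   <⟨ +-mono-≤-< (*-monoˡ-≤ (2 ^ e) (s≤s⁻¹ (m%n<n i 2))) (rev-bounded e (i / 2)) ⟩
  1 * 2 ^ e + 2 ^ e               ≡⟨ +-comm (1 * 2 ^ e) _ ⟩
  2 ^ suc e                       ∎
  where open ≤-Reasoning

digit-unique : ∀ m {a b x y} → x < m → y < m → a * m + x ≡ b * m + y → a ≡ b × x ≡ y
digit-unique m {zero} {zero} _ _ eq = refl , eq
digit-unique m {zero} {suc b} {x} {y} x<m _ eq =
  contradiction (subst (_< m) eq x<m) (≤⇒≯ (≤-trans (m≤m+n m (b * m)) (m≤m+n _ y)))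
digit-unique m {suc a} {zero} {x} {y} _ y<m eq =
  contradiction (subst (_< m) (sym eq) y<m) (≤⇒≯ (≤-trans (m≤m+n m (a * m)) (m≤m+n _ x)))
digit-unique m {suc a} {suc b} {x} {y} x<m y<m eq
  with digit-unique m {a} {b} x<m y<m
    (+-cancelˡ-≡ m _ _ (trans (sym (+-assoc m _ _)) (trans eq (+-assoc m _ _))))
... | refl , x≡y = refl , x≡y

n<2*m⇒n/2<m : ∀ {n m} → n < 2 * m → n / 2 < m
n<2*m⇒n/2<m {n} {m} n<2m = m<n*o⇒m/o<n (subst (n <_) (*-comm 2 m) n<2m)

rev-injective : ∀ e {i j} → i < 2 ^ e → j < 2 ^ e → rev e i ≡ rev e j → i ≡ j
rev-injective zero (s≤s z≤n) (s≤s z≤n) _ = refl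
rev-injective (suc e) {i} {j} i< j< eq
  with digit-unique (2 ^ e) {i % 2} {j % 2} (rev-bounded e (i / 2)) (rev-bounded e (j / 2)) eq
... | %≡ , rev≡ = trans (m≡m%n+[m/n]*n i 2) (trans (cong₂ (λ r q → r + q * 2) %≡ /≡) (sym (m≡m%n+[m/n]*n j 2)))
  where /≡ = rev-injective e (n<2*m⇒n/2<m i<) (n<2*m⇒n/2<m j<) rev≡

rev-digit : ∀ e b i → b < 2 → rev (suc e) (b + i * 2) ≡ b * 2 ^ e + rev e i
rev-digit e b i b<2 = cong₂ (λ r q → r * 2 ^ e + rev e q)
  (trans ([m+kn]%n≡m%n b i 2) (m<n⇒m%n≡m b<2))
  (trans (+-distrib-/-∣ʳ b (n∣m*n i)) (cong₂ _+_ (m<n⇒m/n≡0 b<2) (m*n/n≡m i 2)))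

-- The low k bits of the index are the high k bits of its reversal.
rev-equidistributed : ∀ k g q r → r < 2 ^ k →
  ∃[ p ] (q * 2 ^ k ≤ p × p < suc q * 2 ^ k) ×
         (r * 2 ^ g ≤ rev (k + g) p × rev (k + g) p < suc r * 2 ^ g)
rev-equidistributed zero g q zero r<1 =
  q , (≤-reflexive (*-identityʳ q) , ≤-reflexive (sym (*-identityʳ (suc q)))) ,
  (z≤n , subst (rev g q <_) (sym (*-identityˡ (2 ^ g))) (rev-bounded g q))
rev-equidistributed zero g q (suc r) (s≤s ())
rev-equidistributed (suc k) g q r r<
  with r / 2 ^ k | r % 2 ^ k | m≡m%n+[m/n]*n r (2 ^ k) | m%n<n r (2 ^ k) | m<n*o⇒m/o<n {r} {2} {2 ^ k} r<
  where instance _ = m^n≢0 2 k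
... | b | r′ | r≡ | r′< | b<2 with rev-equidistributed k g q r′ r′<
... | p , (lo , hi) , (rlo , rhi) = b + p * 2 , (lo′ , hi′) , (rlo′ , rhi′)
  where
  open ≤-Reasoning
  e₀ : ∀ q m → q * (2 * m) ≡ q * m * 2
  e₀ = solve-∀
  e₁ : ∀ b r k g → b * (k * g) + r * g ≡ (r + b * k) * g
  e₁ = solve-∀
  e₂ : ∀ b r k g → b * (k * g) + (g + r * g) ≡ g + (r + b * k) * g
  e₂ = solve-∀
  lo′ : q * 2 ^ suc k ≤ b + p * 2
  lo′ = begin
    q * 2 ^ suc k   ≡⟨ e₀ q (2 ^ k) ⟩
    q * 2 ^ k * 2   ≤⟨ *-monoˡ-≤ 2 lo ⟩
    p * 2           ≤⟨ m≤n+m _ b ⟩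
    b + p * 2       ∎
  hi′ : b + p * 2 < suc q * 2 ^ suc k
  hi′ = begin-strict
    b + p * 2           <⟨ +-monoˡ-< (p * 2) b<2 ⟩
    suc p * 2           ≤⟨ *-monoˡ-≤ 2 hi ⟩
    suc q * 2 ^ k * 2   ≡⟨ e₀ (suc q) (2 ^ k) ⟨
    suc q * 2 ^ suc k   ∎
  digit : rev (suc k + g) (b + p * 2) ≡ b * (2 ^ k * 2 ^ g) + rev (k + g) p
  digit = trans (rev-digit (k + g) b p b<2) (cong (λ m → b * m + rev (k + g) p) (^-distribˡ-+-* 2 k g))
  rlo′ : r * 2 ^ g ≤ rev (suc k + g) (b + p * 2)
  rlo′ = begin
    r * 2 ^ g                             ≡⟨ cong (_* 2 ^ g) r≡ ⟩
    (r′ + b * 2 ^ k) * 2 ^ g              ≡⟨ e₁ b r′ (2 ^ k) (2 ^ g) ⟨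
    b * (2 ^ k * 2 ^ g) + r′ * 2 ^ g      ≤⟨ +-monoʳ-≤ (b * (2 ^ k * 2 ^ g)) rlo ⟩
    b * (2 ^ k * 2 ^ g) + rev (k + g) p   ≡⟨ digit ⟨
    rev (suc k + g) (b + p * 2)           ∎
  rhi′ : rev (suc k + g) (b + p * 2) < suc r * 2 ^ g
  rhi′ = begin-strict
    rev (suc k + g) (b + p * 2)           ≡⟨ digit ⟩
    b * (2 ^ k * 2 ^ g) + rev (k + g) p   <⟨ +-monoʳ-< (b * (2 ^ k * 2 ^ g)) rhi ⟩
    b * (2 ^ k * 2 ^ g) + suc r′ * 2 ^ g  ≡⟨ e₂ b r′ (2 ^ k) (2 ^ g) ⟩
    suc (r′ + b * 2 ^ k) * 2 ^ g          ≡⟨ cong (λ x → suc x * 2 ^ g) r≡ ⟨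
    suc r * 2 ^ g                         ∎

-- The lower bound has the factor 2 because a window must have twice the block length to be sure to
-- contain an aligned block; the upper bound converts the scale back into `ℓ`.
dyadic-scale : ∀ ℓ → 2 ≤ ℓ → ∃[ k ] 2 * 2 ^ k ≤ ℓ × ℓ < 4 * 2 ^ k
dyadic-scale (suc zero) (s≤s ())
dyadic-scale (suc (suc zero)) _ = 0 , ≤-refl , s≤s (s≤s (s≤s z≤n))
dyadic-scale (suc (suc (suc ℓ))) _ with dyadic-scale (suc (suc ℓ)) (s≤s (s≤s z≤n))
... | k , lo , hi with suc (suc (suc ℓ)) <? 4 * 2 ^ k
... | yes hi′ = k , m≤n⇒m≤1+n lo , hi′
... | no ¬hi′ = suc k , ≤-trans (≤-reflexive (e (2 ^ k))) (≮⇒≥ ¬hi′)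
    , ≤-<-trans hi (subst (4 * 2 ^ k <_) (sym (e′ (2 ^ k))) (m<m+n (4 * 2 ^ k) (*-mono-≤ (s≤s (z≤n {3})) (m^n>0 2 k))))
  where
  e : ∀ m → 2 * (2 * m) ≡ 4 * m
  e = solve-∀
  e′ : ∀ m → 4 * (2 * m) ≡ 4 * m + 4 * m
  e′ = solve-∀

-- Counting the layers whose reversal lies below a threshold

module _ (e : ℕ) where

  below : ℕ → ℕ → ℕ
  below t p = ⟨ rev e p <? t ⟩

  count : ℕ → ℕ → ℕ
  count t = prefix (below t)

  below-mono : ∀ {t t′} → t ≤ t′ → ∀ p → below t p ≤ below t′ p
  below-mono {t} {t′} t≤t′ p with rev e p <? t
  ... | no _ = z≤n
  ... | yes r<t = ≤-reflexive (sym (⟨⟩≡1 (rev e p <? t′) (<-≤-trans r<t t≤t′)))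

  count≤ : ∀ t j → count t j ≤ j
  count≤ t j = ≤-trans (prefix-≤ (λ p → ⟨⟩≤1 (rev e p <? t)) j) (≤-reflexive (*-identityʳ j))

  below-split : ∀ {t t′} p → t ≤ rev e p → rev e p < t′ → below t p < below t′ p
  below-split {t} {t′} p t≤r r<t′ = ≤-reflexive
    (trans (cong suc (⟨⟩≡0 (rev e p <? t) (≤⇒≯ t≤r))) (sym (⟨⟩≡1 (rev e p <? t′) r<t′)))

  -- Reversal is injective on the first `2 ^ e` layers, so raising the threshold by one admits at
  -- most one further layer. Truncated subtraction makes the bound cover both orders of the
  -- thresholds.
  count-lipschitz : ∀ {j} → j ≤ 2 ^ e → ∀ t t′ → count t′ j ≤ count t j + (t′ ∸ t)
  count-lipschitz {j} j≤ t t′ with ≤-total t t′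
  ... | inj₂ t′≤t = begin
      count t′ j               ≤⟨ prefix-≤-mono (below-mono t′≤t) j ⟩
      count t j                ≤⟨ m≤m+n _ _ ⟩
      count t j + (t′ ∸ t)     ∎
    where
    open ≤-Reasoning
    prefix-≤-mono : ∀ {f g} → (∀ p → f p ≤ g p) → ∀ i → prefix f i ≤ prefix g i
    prefix-≤-mono f≤g i = ≤-trans (m≤m+n _ _) (prefix-window-mono f≤g (z≤n {i}))
  ... | inj₁ t≤t′ = subst (λ u → count u j ≤ count t j + (t′ ∸ t)) (m+[n∸m]≡n t≤t′) (go (t′ ∸ t))
    where
    open ≤-Reasoning
    hit? : ∀ u p → Dec (rev e p ≡ u)
    hit? u p = rev e p ≟ u
    split : ∀ u p → below (suc u) p ≤ below u p + ⟨ hit? u p ⟩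
    split u p with rev e p <? suc u
    ... | no _ = z≤n
    ... | yes (s≤s r≤u) with m≤n⇒m<n∨m≡n r≤u
    ... | inj₁ r<u = ≤-trans (≤-reflexive (sym (⟨⟩≡1 (rev e p <? u) r<u))) (m≤m+n _ _)
    ... | inj₂ r≡u = ≤-trans (≤-reflexive (sym (⟨⟩≡1 (hit? u p) r≡u))) (m≤n+m _ _)
    go : ∀ s → count (t + s) j ≤ count t j + s
    go zero = ≤-reflexive (trans (cong (λ u → count u j) (+-identityʳ t)) (sym (+-identityʳ _)))
    go (suc s) = begin
      count (t + suc s) j                                  ≡⟨ cong (λ u → count u j) (+-suc t s) ⟩
      count (suc (t + s)) j                                ≤⟨ prefix-subadditive (split (t + s)) j ⟩
      count (t + s) j + prefix (⟨_⟩ ∘ hit? (t + s)) j      ≤⟨ +-mono-≤ (go s) (prefix-indicator-≤1 (hit? (t + s)) j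
                                                               λ p<j q<j p≡ q≡ → rev-injective e (<-≤-trans p<j j≤) (<-≤-trans q<j j≤) (trans p≡ (sym q≡))) ⟩
      (count t j + s) + 1                                  ≡⟨ trans (+-assoc _ s 1) (cong (count t j +_) (+-comm s 1)) ⟩
      count t j + suc s                                    ∎

  -- A window of length ℓ contains an aligned dyadic block, whose reversals meet every
  -- dyadic interval of length 2^g; so thresholds 2 · 2^g apart are told apart by the window.
  count-separation : ∀ {i j t t′} → j ≤ 2 ^ e → t′ ≤ 2 ^ e → 2 + i ≤ j →
    count t i + count t′ j ≡ count t j + count t′ i → (t′ ∸ t) * (j ∸ i) < 8 * 2 ^ e
  count-separation {i} {j} {t} {t′} j≤ t′≤ 2+i≤j same
    with dyadic-scale (j ∸ i) (m+n≤o⇒m≤o∸n 2 2+i≤j)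
  ... | k , 2k≤ℓ , ℓ<4k = begin-strict
      (t′ ∸ t) * (j ∸ i)          <⟨ *-mono-< (≰⇒> close) ℓ<4k ⟩
      (2 * 2 ^ g) * (4 * 2 ^ k)   ≡⟨ e₁ (2 ^ g) (2 ^ k) ⟩
      8 * (2 ^ k * 2 ^ g)         ≡⟨ cong (8 *_) (^-distribˡ-+-* 2 k g) ⟨
      8 * 2 ^ (k + g)             ≡⟨ cong (λ x → 8 * 2 ^ x) k+g≡e ⟩
      8 * 2 ^ e                   ∎
    where
    open ≤-Reasoning
    e₁ : ∀ g k → (2 * g) * (4 * k) ≡ 8 * (k * g)
    e₁ = solve-∀
    i≤j : i ≤ j
    i≤j = ≤-trans (m≤n+m i 2) 2+i≤j
    k≤e : k ≤ e
    k≤e with k ≤? e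
    ... | yes p = p
    ... | no k≰e = contradiction (≤-trans (^-monoʳ-≤ 2 (≰⇒> k≰e)) (≤-trans (m≤m+n (2 ^ k) _) (≤-trans 2k≤ℓ (≤-trans (m∸n≤m j i) j≤))))
                     (<⇒≱ (^-monoʳ-< 2 (s≤s (s≤s z≤n)) (n<1+n e)))
    g = e ∸ k
    k+g≡e : k + g ≡ e
    k+g≡e = m+[n∸m]≡n k≤e
    instance
      _ = m^n≢0 2 k
      _ = m^n≢0 2 g
    next : ∀ x m .{{_ : NonZero m}} → x ≤ suc (x / m) * m
    next x m = begin
      x                      ≡⟨ m≡m%n+[m/n]*n x m ⟩
      x % m + x / m * m      ≤⟨ +-monoˡ-≤ (x / m * m) (<⇒≤ (m%n<n x m)) ⟩
      suc (x / m) * m        ∎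
    next-fits : ∀ x m {y} .{{_ : NonZero m}} → x + 2 * m ≤ y → suc (suc (x / m)) * m ≤ y
    next-fits x m {y} fits = begin
      suc (suc (x / m)) * m    ≡⟨ e₂ (x / m) m ⟩
      x / m * m + 2 * m        ≤⟨ +-monoˡ-≤ (2 * m) (m/n*n≤m x m) ⟩
      x + 2 * m                ≤⟨ fits ⟩
      y                        ∎
      where
      e₂ : ∀ x m → m + (m + x * m) ≡ x * m + 2 * m
      e₂ = solve-∀
    -- The first aligned block of layers that begins after `i`, and likewise the first dyadic
    -- interval of reversals that begins after `t`.
    q = suc (i / 2 ^ k)
    r = suc (t / 2 ^ g)
    close : ¬ 2 * 2 ^ g ≤ t′ ∸ t
    close far =
      let p , (lo , hi) , (rlo , rhi) = rev-equidistributed k g q r r<2^k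
      -- The layer `p` lies in the window and its reversal lies between the thresholds, so it is
      -- counted for `t′` and not for `t`; the two window counts cannot agree.
      in <⇒≢
        (prefix-window-strict (below-mono (<⇒≤ t<t′))
          (≤-trans (next i (2 ^ k)) lo) (<-≤-trans hi (next-fits i (2 ^ k) i+2k≤j))
          (below-split p (≤-trans (next t (2 ^ g)) (fits rlo)) (<-≤-trans (fits′ rhi) (next-fits t (2 ^ g) t+2g≤t′))))
        (sym same)
      where
      t<t′ : t < t′
      t<t′ = m∸n≢0⇒n<m λ eq → <⇒≱ (*-mono-≤ (s≤s (z≤n {1})) (m^n>0 2 g)) (≤-trans far (≤-reflexive eq))
      t+2g≤t′ : t + 2 * 2 ^ g ≤ t′
      t+2g≤t′ = ≤-trans (+-monoʳ-≤ t far) (≤-reflexive (m+[n∸m]≡n (<⇒≤ t<t′)))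
      i+2k≤j : i + 2 * 2 ^ k ≤ j
      i+2k≤j = ≤-trans (+-monoʳ-≤ i 2k≤ℓ) (≤-reflexive (m+[n∸m]≡n i≤j))
      r<2^k : r < 2 ^ k
      r<2^k = *-cancelʳ-≤ (suc r) (2 ^ k) (2 ^ g) (begin
        suc r * 2 ^ g     ≤⟨ next-fits t (2 ^ g) t+2g≤t′ ⟩
        t′                ≤⟨ t′≤ ⟩
        2 ^ e             ≡⟨ cong (2 ^_) k+g≡e ⟨
        2 ^ (k + g)       ≡⟨ ^-distribˡ-+-* 2 k g ⟩
        2 ^ k * 2 ^ g     ∎)
      fits : ∀ {p} → r * 2 ^ g ≤ rev (k + g) p → r * 2 ^ g ≤ rev e p
      fits {p} = subst (λ x → r * 2 ^ g ≤ rev x p) k+g≡e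
      fits′ : ∀ {p} → rev (k + g) p < suc r * 2 ^ g → rev e p < suc r * 2 ^ g
      fits′ {p} = subst (λ x → rev x p < suc r * 2 ^ g) k+g≡e

-- Sums over lists and counting by injection

∑ : {X : Set} → List X → (X → ℕ) → ℕ
∑ xs f = sum (map f xs)

+-interchange : ∀ a b c d → (a + b) + (c + d) ≡ (a + c) + (b + d)
+-interchange = solve-∀

module _ {X : Set} where

  ∑-mono : ∀ (xs : List X) {f g : X → ℕ} → (∀ x → f x ≤ g x) → ∑ xs f ≤ ∑ xs g
  ∑-mono [] f≤g = z≤n
  ∑-mono (x ∷ xs) f≤g = +-mono-≤ (f≤g x) (∑-mono xs f≤g)

  ∑-+ : ∀ (xs : List X) (f g : X → ℕ) → ∑ xs (λ x → f x + g x) ≡ ∑ xs f + ∑ xs g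
  ∑-+ [] f g = refl
  ∑-+ (x ∷ xs) f g = trans (cong (f x + g x +_) (∑-+ xs f g)) (+-interchange (f x) (g x) (∑ xs f) (∑ xs g))

  ∑-zero : ∀ (xs : List X) → ∑ xs (λ _ → 0) ≡ 0
  ∑-zero [] = refl
  ∑-zero (x ∷ xs) = ∑-zero xs

  ∑-*ʳ : ∀ (xs : List X) (f : X → ℕ) c → ∑ xs (λ x → f x * c) ≡ ∑ xs f * c
  ∑-*ʳ [] f c = refl
  ∑-*ʳ (x ∷ xs) f c = trans (cong (f x * c +_) (∑-*ʳ xs f c)) (sym (*-distribʳ-+ c (f x) (∑ xs f)))

  ∑-≤ : ∀ (xs : List X) {f c} → (∀ x → f x ≤ c) → ∑ xs f ≤ length xs * c
  ∑-≤ [] f≤c = z≤n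
  ∑-≤ (x ∷ xs) f≤c = +-mono-≤ (f≤c x) (∑-≤ xs f≤c)

  ∑-pigeonhole : ∀ (xs : List X) {f c} → ∑ xs f < length xs * c → ∃[ x ] f x < c
  ∑-pigeonhole (x ∷ xs) {f} {c} small with f x <? c
  ... | yes fx<c = x , fx<c
  ... | no fx≮c = ∑-pigeonhole xs (+-cancelˡ-< c _ _ (≤-<-trans (+-monoˡ-≤ (∑ xs f) (≮⇒≥ fx≮c)) small))

  -- A single list entry absorbs the whole surplus `c`; in this way one shortcut is credited with
  -- its span in `progress-jump`.
  ∑-mono-+ : ∀ {xs : List X} {f g : X → ℕ} {x} c → (∀ y → f y ≤ g y) → x ∈ xs → f x + c ≤ g x →
    ∑ xs f + c ≤ ∑ xs g
  ∑-mono-+ {x ∷ xs} {f} {g} c f≤g (here refl) gap = begin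
    (f x + ∑ xs f) + c   ≡⟨ swapʳ (f x) (∑ xs f) c ⟩
    (f x + c) + ∑ xs f   ≤⟨ +-mono-≤ gap (∑-mono xs f≤g) ⟩
    g x + ∑ xs g         ∎
    where
    open ≤-Reasoning
    swapʳ : ∀ a b c → (a + b) + c ≡ (a + c) + b
    swapʳ = solve-∀
  ∑-mono-+ {y ∷ xs} {f} {g} c f≤g (there x∈xs) gap =
    ≤-trans (≤-reflexive (+-assoc (f y) (∑ xs f) c)) (+-mono-≤ (f≤g y) (∑-mono-+ c f≤g x∈xs gap))

  lookup-injective : ∀ {xs : List X} → Unique xs → ∀ {i j} → lookup xs i ≡ lookup xs j → i ≡ j
  lookup-injective {x ∷ xs} (x∉ ∷ _) {Fin.zero} {Fin.zero} _ = refl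
  lookup-injective {x ∷ xs} (x∉ ∷ _) {Fin.zero} {Fin.suc j} eq = contradiction eq (All.lookup x∉ (∈-lookup j))
  lookup-injective {x ∷ xs} (x∉ ∷ _) {Fin.suc i} {Fin.zero} eq = contradiction (sym eq) (All.lookup x∉ (∈-lookup i))
  lookup-injective {x ∷ xs} (_ ∷ uniq) {Fin.suc i} {Fin.suc j} eq = cong Fin.suc (lookup-injective uniq eq)

  injection⇒length≤ : ∀ {xs : List X} {m} → Unique xs → (f : X → Fin m) →
    (∀ {x y} → x ∈ xs → y ∈ xs → f x ≡ f y → x ≡ y) → length xs ≤ m
  injection⇒length≤ {xs} uniq f inj = injective⇒≤ {f = f ∘ lookup xs}
    λ {i} {j} eq → lookup-injective uniq (inj (∈-lookup i) (∈-lookup j) eq)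

  ∑-indicator : ∀ {P : X → Set} (P? : ∀ x → Dec (P x)) xs → ∑ xs (⟨_⟩ ∘ P?) ≡ length (filter P? xs)
  ∑-indicator P? [] = refl
  ∑-indicator P? (x ∷ xs) with P? x
  ... | yes _ = cong suc (∑-indicator P? xs)
  ... | no _ = ∑-indicator P? xs

  injection⇒∑≤ : ∀ {xs : List X} {m} {P : X → Set} (P? : ∀ x → Dec (P x)) → Unique xs → (f : X → Fin m) →
    (∀ {x y} → P x → P y → f x ≡ f y → x ≡ y) → ∑ xs (⟨_⟩ ∘ P?) ≤ m
  injection⇒∑≤ {xs} P? uniq f inj = ≤-trans (≤-reflexive (∑-indicator P? xs))
    (injection⇒length≤ (filter⁺ P? uniq) f
      λ x∈ y∈ → inj (proj₂ (∈-filter⁻ P? {xs = xs} x∈)) (proj₂ (∈-filter⁻ P? {xs = xs} y∈)))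

  enumerate : ∀ {m} → Fin m ↔ X → List X
  enumerate {m} iso = map (Inverse.to iso) (allFin m)

  enumerate-unique : ∀ {m} (iso : Fin m ↔ X) → Unique (enumerate iso)
  enumerate-unique {m} iso = map⁺ (Injection.injective (↔⇒↣ iso)) (allFin⁺ m)

  length-enumerate : ∀ {m} (iso : Fin m ↔ X) → length (enumerate iso) ≡ m
  length-enumerate {m} iso = trans (length-map (Inverse.to iso) (allFin m)) (length-tabulate {n = m} λ i → i)

∑-swap : ∀ {X Y : Set} (xs : List X) (ys : List Y) (f : X → Y → ℕ) →
  ∑ xs (λ x → ∑ ys (f x)) ≡ ∑ ys (λ y → ∑ xs (λ x → f x y))
∑-swap [] ys f = sym (∑-zero ys)
∑-swap (x ∷ xs) ys f = trans (cong (∑ ys (f x) +_) (∑-swap xs ys f)) (sym (∑-+ ys (f x) λ y → ∑ xs (λ x → f x y)))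

-- Turns closeness into counting: numbers that are pairwise less than `w` apart are told apart by
-- their residues, so there are at most `w` of them.
%-≡⇒≡ : ∀ w .{{_ : NonZero w}} {a b} → a % w ≡ b % w → b ∸ a < w → a ∸ b < w → a ≡ b
%-≡⇒≡ w {a} {b} eq b∸a<w a∸b<w = trans (m≡m%n+[m/n]*n a w)
  (trans (cong₂ (λ r q → r + q * w) eq (≤-antisym (q≤ a b eq a∸b<w) (q≤ b a (sym eq) b∸a<w)))
         (sym (m≡m%n+[m/n]*n b w)))
  where
  open ≤-Reasoning
  q≤ : ∀ a b → a % w ≡ b % w → a ∸ b < w → a / w ≤ b / w
  q≤ a b eq a∸b<w with a / w ≤? b / w
  ... | yes p = p
  ... | no ¬p = contradiction a∸b<w (≤⇒≯ (m+n≤o⇒m≤o∸n w (begin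
    w + b                          ≡⟨ cong (w +_) (trans (m≡m%n+[m/n]*n b w) (cong (_+ b / w * w) (sym eq))) ⟩
    w + (a % w + b / w * w)        ≡⟨ e w (a % w) (b / w * w) ⟩
    a % w + suc (b / w) * w        ≤⟨ +-monoʳ-≤ (a % w) (*-monoˡ-≤ w (≰⇒> ¬p)) ⟩
    a % w + a / w * w              ≡⟨ m≡m%n+[m/n]*n a w ⟨
    a                              ∎)))
    where
    e : ∀ w r q → w + (r + q) ≡ r + (w + q)
    e = solve-∀

-- The potential in one coordinate

module _ (e : ℕ) where

  -- Odd, so that it never equals an (even) doubled threshold: this is what makes the
  -- optimal choice at every layer unique.
  slope : ℕ → ℕ
  slope p = suc (2 * rev e p)

  weight : ℕ → ℕ → ℕ
  weight t = prefix λ p → below e t p * slope p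

  -- A bit at layer `p` changes `Y + 2 t X` by `slope p - 2 t` if set and by 0 otherwise. The
  -- summand is the largest possible decrease, so adding it makes the total non-decreasing.
  gain : ℕ → ℕ → ℕ
  gain t = prefix λ p → 2 * t ∸ slope p

  slope≤2t : ∀ {t p} → rev e p < t → slope p ≤ 2 * t
  slope≤2t {t} {p} r<t = ≤-trans (n≤1+n _) (≤-trans (≤-reflexive (e₁ (rev e p))) (*-monoʳ-≤ 2 r<t))
    where
    e₁ : ∀ r → suc (suc (2 * r)) ≡ 2 * suc r
    e₁ = solve-∀

  below-gain : ∀ t p → (2 * t ∸ slope p) + below e t p * slope p ≡ 2 * t * below e t p
  below-gain t p with rev e p <? t
  ... | yes r<t = trans (cong (2 * t ∸ slope p +_) (+-identityʳ _)) (trans (m∸n+n≡m (slope≤2t r<t)) (sym (*-identityʳ _)))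
  ... | no r≮t = trans (+-identityʳ _) (trans (m≤n⇒m∸n≡0 (≤-trans (*-monoʳ-≤ 2 (≮⇒≥ r≮t)) (n≤1+n _))) (sym (*-zeroʳ (2 * t))))

  gain+weight : ∀ t i → gain t i + weight t i ≡ 2 * t * count e t i
  gain+weight t zero = sym (*-zeroʳ (2 * t))
  gain+weight t (suc i) = begin
    (gain t i + (2 * t ∸ slope i)) + (weight t i + below e t i * slope i)   ≡⟨ +-interchange (gain t i) _ _ _ ⟩
    (gain t i + weight t i) + ((2 * t ∸ slope i) + below e t i * slope i)   ≡⟨ cong₂ _+_ (gain+weight t i) (below-gain t i) ⟩
    2 * t * count e t i + 2 * t * below e t i                               ≡⟨ *-distribˡ-+ (2 * t) _ _ ⟨
    2 * t * count e t (suc i)                                               ∎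
    where open ≡-Reasoning

  bit-gain : ∀ t p {b} → b ≤ 1 → 2 * t * b ≤ (2 * t ∸ slope p) + b * slope p
  bit-gain t p z≤n = ≤-trans (≤-reflexive (*-zeroʳ (2 * t))) z≤n
  bit-gain t p (s≤s z≤n) = ≤-trans (≤-reflexive (*-identityʳ _))
    (≤-trans (m≤n+m∸n (2 * t) (slope p)) (≤-reflexive (trans (+-comm (slope p) _) (cong (2 * t ∸ slope p +_) (sym (+-identityʳ _))))))

  -- For `b = 0` tightness makes the gain vanish, that is `2 t ≤ slope p`; for `b = 1` it gives
  -- `slope p ≤ 2 t`. As the slope is odd, each inequality decides on which side of `t` the reversal
  -- lies.
  bit-gain-tight : ∀ t p {b} → b ≤ 1 → (2 * t ∸ slope p) + b * slope p ≤ 2 * t * b → b ≡ below e t p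
  bit-gain-tight t p z≤n tight = sym (⟨⟩≡0 (rev e p <? t) λ r<t →
    <⇒≱ (m<n⇒0<n∸m (strict r<t)) (≤-trans (≤-reflexive (sym (+-identityʳ _))) (≤-trans tight (≤-reflexive (*-zeroʳ (2 * t))))))
    where
    strict : rev e p < t → slope p < 2 * t
    strict r<t = ≤-trans (≤-reflexive (e₁ (rev e p))) (*-monoʳ-≤ 2 r<t)
      where
      e₁ : ∀ r → suc (suc (2 * r)) ≡ 2 * suc r
      e₁ = solve-∀
  bit-gain-tight t p (s≤s z≤n) tight = sym (⟨⟩≡1 (rev e p <? t) (*-cancelˡ-< 2 _ _
    (≤-trans (m≤n+m (slope p) (2 * t ∸ slope p))
      (≤-trans (≤-reflexive (cong (2 * t ∸ slope p +_) (sym (+-identityʳ _)))) (≤-trans tight (≤-reflexive (*-identityʳ _)))))))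

m*n<o⇒m<1+o/n : ∀ m n {o} .{{_ : NonZero n}} → m * n < o → m < suc (o / n)
m*n<o⇒m<1+o/n m n {o} m*n<o with m ≤? o / n
... | yes p = s≤s p
... | no ¬p = contradiction m*n<o (<-asym (begin-strict
  o                      ≡⟨ m≡m%n+[m/n]*n o n ⟩
  o % n + o / n * n      <⟨ +-monoˡ-< (o / n * n) (m%n<n o n) ⟩
  suc (o / n) * n        ≤⟨ *-monoˡ-≤ n (≰⇒> ¬p) ⟩
  m * n                  ∎))
  where open ≤-Reasoning

snoc : ∀ {n} {E : EdgeList n} {u v w k} → Walk E u v k → (v , w) ∈ E → Walk E u w (suc k)
snoc here vw∈E = step vw∈E here
snoc (step uu′∈E walk) vw∈E = step uu′∈E (snoc walk vw∈E)

∣++∣ : ∀ {m n} (p : Subset m) (q : Subset n) → ∣ p ++ᵛ q ∣ ≡ ∣ p ∣ + ∣ q ∣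
∣++∣ Vec.[] q = refl
∣++∣ (inside Vec.∷ p) q = cong suc (∣++∣ p q)
∣++∣ (outside Vec.∷ p) q = ∣++∣ p q

-- The network

tight-sum : ∀ b {x₁ x₂ y₁ y₂} → x₁ ≤ y₁ → x₂ ≤ y₂ → b + (y₁ + y₂) ≤ b + (x₁ + x₂) → y₁ ≤ x₁ × y₂ ≤ x₂
tight-sum b {x₁} {x₂} {y₁} {y₂} x₁≤y₁ x₂≤y₂ tight =
  +-cancelʳ-≤ x₂ y₁ x₁ (≤-trans (+-monoʳ-≤ y₁ x₂≤y₂) tight′) ,
  +-cancelˡ-≤ x₁ y₂ x₂ (≤-trans (+-monoˡ-≤ y₂ x₁≤y₁) tight′)
  where tight′ = +-cancelˡ-≤ b (y₁ + y₂) (x₁ + x₂) tight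

-- Here `x` and `y` are a coordinate at two vertices shared by two paths, with sources `s` and `s′`.
-- Eliminating all four leaves the equality of window counts that `count-separation` requires.
same-window : ∀ {x y a b a′ b′ s s′} → x + a ≡ s → y + b ≡ s → x + a′ ≡ s′ → y + b′ ≡ s′ → a + b′ ≡ b + a′
same-window {x} {y} {a} {b} {a′} {b′} refl q refl q′ = +-cancelˡ-≡ (x + y) _ _ (begin
  (x + y) + (a + b′)   ≡⟨ +-interchange x y a b′ ⟩
  (x + a) + (y + b′)   ≡⟨ cong₂ _+_ (sym q) q′ ⟩
  (y + b) + (x + a′)   ≡⟨ e x y b a′ ⟩
  (x + y) + (b + a′)   ∎)
  where
  open ≡-Reasoning
  e : ∀ x y b a′ → (y + b) + (x + a′) ≡ (x + y) + (b + a′)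
  e = solve-∀

-- `A` initial values of x₂ at spacing `σ` fill a range of length `D`; `h` is a quarter of the
-- layers and `Q` the number of copies.
module Network (e A σ h Q : ℕ) (1≤A : 1 ≤ A) (A*σ≡D : A * σ ≡ 2 ^ e) (4*h≡D : 4 * h ≡ 2 ^ e) where

  D : ℕ
  D = 2 ^ e

  1≤D : 1 ≤ D
  1≤D = m^n>0 2 e

  -- (s₁, s₂, s₃) stands for the initial x₁, x₂ and y; grid vertices are (copy, layer, x₁, x₂, y).
  Source Grid Vertex : Set
  Source = Fin D × Fin A × Fin (D * D)
  Grid = Fin Q × Fin (suc D) × Fin (D + D) × Fin (D + D) × Fin (5 * (D * D))
  Vertex = Source ⊎ Grid

  sources grid size : ℕ
  sources = D * (A * (D * D))
  grid = Q * (suc D * ((D + D) * ((D + D) * (5 * (D * D)))))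
  size = sources + grid

  Fin↔Source : Fin sources ↔ Source
  Fin↔Source = ↔-trans *↔× (↔-refl ×-↔ *↔×)

  Fin↔Grid : Fin grid ↔ Grid
  Fin↔Grid = ↔-trans *↔× (↔-refl ×-↔ ↔-trans *↔× (↔-refl ×-↔ ↔-trans *↔× (↔-refl ×-↔ *↔×)))

  Fin↔Vertex : Fin size ↔ Vertex
  Fin↔Vertex = ↔-trans +↔⊎ (Fin↔Source ⊎-↔ Fin↔Grid)

  -- The offset `D` leaves room for the at most `D` unit decrements along a path.
  srcX₁ srcX₂ srcY : Source → ℕ
  srcX₁ (s₁ , _) = D + toℕ s₁
  srcX₂ (_ , s₂ , _) = D + toℕ s₂ * σ
  srcY (_ , _ , s₃) = toℕ s₃

  layer X₁ X₂ Y : Vertex → ℕ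
  layer (inj₁ _) = 0
  layer (inj₂ (_ , i , _)) = toℕ i
  X₁ (inj₁ s) = srcX₁ s
  X₁ (inj₂ (_ , _ , x , _)) = toℕ x
  X₂ (inj₁ s) = srcX₂ s
  X₂ (inj₂ (_ , _ , _ , x , _)) = toℕ x
  Y (inj₁ s) = srcY s
  Y (inj₂ (_ , _ , _ , _ , y)) = toℕ y

  layer≤D : ∀ u → layer u ≤ D
  layer≤D (inj₁ _) = z≤n
  layer≤D (inj₂ (_ , i , _)) = s≤s⁻¹ (toℕ<n i)

  -- A source is joined to every copy, so it counts as a member of each.
  InCopy : Fin Q → Vertex → Set
  InCopy c (inj₁ _) = ⊤
  InCopy c (inj₂ (c′ , _)) = c ≡ c′

  InCopy? : ∀ c u → Dec (InCopy c u)
  InCopy? c (inj₁ _) = yes tt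
  InCopy? c (inj₂ (c′ , _)) = c Fin.≟ c′

  -- The x-coordinates count down, which keeps the potential below free of subtraction.
  Step : Vertex → Vertex → Set
  Step u v = layer v ≡ suc (layer u) ×
    (bit₁ ≤ 1 × X₁ u ≡ bit₁ + X₁ v) × (bit₂ ≤ 1 × X₂ u ≡ bit₂ + X₂ v) ×
    Y v ≡ Y u + (bit₁ + bit₂) * slope e (layer u)
    where
    bit₁ = X₁ u ∸ X₁ v
    bit₂ = X₂ u ∸ X₂ v

  -- The edges from a source to its image in each copy.
  Stay : Vertex → Vertex → Set
  Stay u v = layer v ≡ layer u × X₁ u ≡ X₁ v × X₂ u ≡ X₂ v × Y v ≡ Y u

  Adj : Vertex → Vertex → Set
  Adj (inj₁ s) (inj₂ g) = Stay (inj₁ s) (inj₂ g)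
  Adj (inj₂ g) (inj₂ g′) = proj₁ g ≡ proj₁ g′ × Step (inj₂ g) (inj₂ g′)
  Adj _ (inj₁ _) = ⊥

  Step? : ∀ u v → Dec (Step u v)
  Step? u v = (_ ≟ _) ×-dec ((_ ≤? _) ×-dec (_ ≟ _)) ×-dec ((_ ≤? _) ×-dec (_ ≟ _)) ×-dec (_ ≟ _)

  Stay? : ∀ u v → Dec (Stay u v)
  Stay? u v = (_ ≟ _) ×-dec (_ ≟ _) ×-dec (_ ≟ _) ×-dec (_ ≟ _)

  Adj? : ∀ u v → Dec (Adj u v)
  Adj? (inj₁ s) (inj₂ g) = Stay? (inj₁ s) (inj₂ g)
  Adj? (inj₂ g) (inj₂ g′) = (_ Fin.≟ _) ×-dec Step? (inj₂ g) (inj₂ g′)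
  Adj? (inj₁ _) (inj₁ _) = no λ ()
  Adj? (inj₂ _) (inj₁ _) = no λ ()

  Adj⇒Stay⊎Step : ∀ {u v} → Adj u v → Stay u v ⊎ Step u v
  Adj⇒Stay⊎Step {inj₁ _} {inj₂ _} stay = inj₁ stay
  Adj⇒Stay⊎Step {inj₂ _} {inj₂ _} (_ , move) = inj₂ move

  Adj⇒InCopy : ∀ {c u v} → Adj u v → InCopy c v → InCopy c u
  Adj⇒InCopy {u = inj₁ _} _ _ = tt
  Adj⇒InCopy {u = inj₂ _} {v = inj₂ _} (refl , _) c≡ = c≡

  Adj⇒layer≤ : ∀ {u v} → Adj u v → layer u ≤ layer v
  Adj⇒layer≤ adj with Adj⇒Stay⊎Step adj
  ... | inj₁ (eq , _) = ≤-reflexive (sym eq)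
  ... | inj₂ (eq , _) = ≤-trans (n≤1+n _) (≤-reflexive (sym eq))

  Adj⇒layer≤1+ : ∀ {u v} → Adj u v → layer v ≤ suc (layer u)
  Adj⇒layer≤1+ adj with Adj⇒Stay⊎Step adj
  ... | inj₁ (eq , _) = ≤-trans (≤-reflexive eq) (n≤1+n _)
  ... | inj₂ (eq , _) = ≤-reflexive eq

  Adj-irreflexive : ∀ {u} → ¬ Adj u u
  Adj-irreflexive {inj₂ _} (_ , eq , _) = contradiction eq (<⇒≢ (n<1+n _))

  -- Two thresholds, a source and a copy.
  Path : Set
  Path = (Fin D × Fin D) × Source × Fin Q

  pathCount : ℕ
  pathCount = (D * D) * (sources * Q)

  Fin↔Path : Fin pathCount ↔ Path
  Fin↔Path = ↔-trans *↔× (*↔× ×-↔ ↔-trans *↔× (Fin↔Source ×-↔ ↔-refl))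

  paths : List Path
  paths = enumerate Fin↔Path

  -- The potential of a path

  module _ (π : Path) where

    threshold₁ threshold₂ : ℕ
    threshold₁ = toℕ (proj₁ (proj₁ π))
    threshold₂ = toℕ (proj₂ (proj₁ π))

    source : Source
    source = proj₁ (proj₂ π)

    copy : Fin Q
    copy = proj₂ (proj₂ π)

    -- Only the layer and the coordinates enter, so that the condition applies to sources and grid
    -- vertices alike; the copy is tracked separately by `InCopy`.
    On : Vertex → Set
    On u = X₁ u + count e threshold₁ (layer u) ≡ srcX₁ source ×
           X₂ u + count e threshold₂ (layer u) ≡ srcX₂ source ×
           Y u ≡ srcY source + (weight e threshold₁ (layer u) + weight e threshold₂ (layer u))

    On? : ∀ u → Dec (On u)
    On? u = (_ ≟ _) ×-dec (_ ≟ _) ×-dec (_ ≟ _)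

    potential : Vertex → ℕ
    potential u = ((gain e threshold₁ (layer u) + gain e threshold₂ (layer u)) + Y u)
                + (2 * threshold₁ * X₁ u + 2 * threshold₂ * X₂ u)

    pathPotential : ℕ
    pathPotential = srcY source + (2 * threshold₁ * srcX₁ source + 2 * threshold₂ * srcX₂ source)

    -- In each coordinate `gain + weight` equals `2 t` times the count, which is exactly what the
    -- term `2 t X` has lost since the source.
    On⇒potential : ∀ {u} → On u → potential u ≡ pathPotential
    On⇒potential {u} (x₁≡ , x₂≡ , y≡) = begin
      ((g₁ + g₂) + Y u) + (T₁ * X₁ u + T₂ * X₂ u)
        ≡⟨ cong (λ y → ((g₁ + g₂) + y) + (T₁ * X₁ u + T₂ * X₂ u)) y≡ ⟩
      ((g₁ + g₂) + (srcY source + (w₁ + w₂))) + (T₁ * X₁ u + T₂ * X₂ u)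
        ≡⟨ e₁ g₁ g₂ (srcY source) w₁ w₂ (T₁ * X₁ u) (T₂ * X₂ u) ⟩
      srcY source + ((T₁ * X₁ u + (g₁ + w₁)) + (T₂ * X₂ u + (g₂ + w₂)))
        ≡⟨ cong₂ (λ a b → srcY source + (a + b)) (coordinate threshold₁ x₁≡) (coordinate threshold₂ x₂≡) ⟩
      pathPotential ∎
      where
      open ≡-Reasoning
      T₁ = 2 * threshold₁
      T₂ = 2 * threshold₂
      g₁ = gain e threshold₁ (layer u)
      g₂ = gain e threshold₂ (layer u)
      w₁ = weight e threshold₁ (layer u)
      w₂ = weight e threshold₂ (layer u)
      e₁ : ∀ g₁ g₂ y w₁ w₂ p q → ((g₁ + g₂) + (y + (w₁ + w₂))) + (p + q) ≡ y + ((p + (g₁ + w₁)) + (q + (g₂ + w₂)))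
      e₁ = solve-∀
      coordinate : ∀ t {x s} → x + count e t (layer u) ≡ s →
        2 * t * x + (gain e t (layer u) + weight e t (layer u)) ≡ 2 * t * s
      coordinate t {x} refl = trans (cong (2 * t * x +_) (gain+weight e t (layer u))) (sym (*-distribˡ-+ (2 * t) x _))

    module _ {u v : Vertex} (move : Step u v) where
      private
        bit₁ = X₁ u ∸ X₁ v
        bit₂ = X₂ u ∸ X₂ v
        p = layer u
        T₁ = 2 * threshold₁
        T₂ = 2 * threshold₂
        layer≡ = proj₁ move
        bit₁≤1 = proj₁ (proj₁ (proj₂ move))
        X₁≡ = proj₂ (proj₁ (proj₂ move))
        bit₂≤1 = proj₁ (proj₁ (proj₂ (proj₂ move)))
        X₂≡ = proj₂ (proj₁ (proj₂ (proj₂ move)))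
        Y≡ = proj₂ (proj₂ (proj₂ move))
        -- `base` is common to the potentials of both ends; what remains, `before` and `after`, is a
        -- sum over the two coordinates to which `bit-gain` applies separately.
        base = ((gain e threshold₁ p + gain e threshold₂ p) + Y u) + (T₁ * X₁ v + T₂ * X₂ v)
        before = T₁ * bit₁ + T₂ * bit₂
        after = ((T₁ ∸ slope e p) + bit₁ * slope e p) + ((T₂ ∸ slope e p) + bit₂ * slope e p)

        potential-before : potential u ≡ base + before
        potential-before = trans
          (cong₂ (λ x₁ x₂ → ((gain e threshold₁ p + gain e threshold₂ p) + Y u) + (T₁ * x₁ + T₂ * x₂)) X₁≡ X₂≡)
          (e₁ ((gain e threshold₁ p + gain e threshold₂ p) + Y u) T₁ bit₁ (X₁ v) T₂ bit₂ (X₂ v))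
          where
          e₁ : ∀ g T₁ b₁ x₁ T₂ b₂ x₂ → g + (T₁ * (b₁ + x₁) + T₂ * (b₂ + x₂)) ≡ (g + (T₁ * x₁ + T₂ * x₂)) + (T₁ * b₁ + T₂ * b₂)
          e₁ = solve-∀

        potential-after : potential v ≡ base + after
        potential-after = trans
          (cong₂ (λ i y → ((gain e threshold₁ i + gain e threshold₂ i) + y) + (T₁ * X₁ v + T₂ * X₂ v)) layer≡ Y≡)
          (e₁ (gain e threshold₁ p) (gain e threshold₂ p) (Y u) (T₁ * X₁ v + T₂ * X₂ v)
              (T₁ ∸ slope e p) bit₁ (slope e p) (T₂ ∸ slope e p) bit₂)
          where
          e₁ : ∀ g₁ g₂ y X d₁ b₁ s d₂ b₂ →
            (((g₁ + d₁) + (g₂ + d₂)) + (y + (b₁ + b₂) * s)) + X ≡ (((g₁ + g₂) + y) + X) + ((d₁ + b₁ * s) + (d₂ + b₂ * s))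
          e₁ = solve-∀

      Step⇒potential≤ : potential u ≤ potential v
      Step⇒potential≤ = begin
        potential u      ≡⟨ potential-before ⟩
        base + before    ≤⟨ +-monoʳ-≤ base (+-mono-≤ (bit-gain e threshold₁ p bit₁≤1) (bit-gain e threshold₂ p bit₂≤1)) ⟩
        base + after     ≡⟨ potential-after ⟨
        potential v      ∎
        where open ≤-Reasoning

      -- If the potential does not rise, both coordinates are tight, so both bits are the threshold
      -- bits and the step follows the path.
      Step⇒On : On u → potential v ≤ potential u → On v
      Step⇒On (x₁≡ , x₂≡ , y≡) tight =
        coordinate (count e threshold₁) X₁≡ (cong (count e threshold₁ p +_) bit₁≡) x₁≡ ,
        coordinate (count e threshold₂) X₂≡ (cong (count e threshold₂ p +_) bit₂≡) x₂≡ ,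
        (begin
          Y v
            ≡⟨ Y≡ ⟩
          Y u + (bit₁ + bit₂) * slope e p
            ≡⟨ cong₂ (λ y b → y + b * slope e p) y≡ (cong₂ _+_ bit₁≡ bit₂≡) ⟩
          (srcY source + (weight e threshold₁ p + weight e threshold₂ p)) + (below e threshold₁ p + below e threshold₂ p) * slope e p
            ≡⟨ e₁ (srcY source) (weight e threshold₁ p) (weight e threshold₂ p) (below e threshold₁ p) (below e threshold₂ p) (slope e p) ⟩
          srcY source + (weight e threshold₁ (suc p) + weight e threshold₂ (suc p))
            ≡⟨ cong (λ i → srcY source + (weight e threshold₁ i + weight e threshold₂ i)) layer≡ ⟨
          srcY source + (weight e threshold₁ (layer v) + weight e threshold₂ (layer v)) ∎)
        where
        open ≡-Reasoning
        tights = tight-sum base (bit-gain e threshold₁ p bit₁≤1) (bit-gain e threshold₂ p bit₂≤1)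
          (≤-trans (≤-reflexive (sym potential-after)) (≤-trans tight (≤-reflexive potential-before)))
        bit₁≡ = bit-gain-tight e threshold₁ p bit₁≤1 (proj₁ tights)
        bit₂≡ = bit-gain-tight e threshold₂ p bit₂≤1 (proj₂ tights)
        e₁ : ∀ y w₁ w₂ b₁ b₂ s → (y + (w₁ + w₂)) + (b₁ + b₂) * s ≡ y + ((w₁ + b₁ * s) + (w₂ + b₂ * s))
        e₁ = solve-∀
        e₂ : ∀ x c b → x + (c + b) ≡ (b + x) + c
        e₂ = solve-∀
        coordinate : ∀ (f : ℕ → ℕ) {x x′ b s} → x ≡ b + x′ → f p + b ≡ f (suc p) → x + f p ≡ s → x′ + f (layer v) ≡ s
        coordinate f {x} {x′} {b} {s} refl f≡ eq = begin
          x′ + f (layer v)     ≡⟨ cong (λ i → x′ + f i) layer≡ ⟩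
          x′ + f (suc p)       ≡⟨ cong (x′ +_) f≡ ⟨
          x′ + (f p + b)       ≡⟨ e₂ x′ (f p) b ⟩
          (b + x′) + f p       ≡⟨ eq ⟩
          s                    ∎

    Adj⇒potential≤ : ∀ {u v} → Adj u v → potential u ≤ potential v
    Adj⇒potential≤ {u} {v} adj with Adj⇒Stay⊎Step {u} {v} adj
    ... | inj₂ move = Step⇒potential≤ {u} {v} move
    ... | inj₁ (layer≡ , x₁≡ , x₂≡ , y≡) = ≤-reflexive
      (cong₂ _+_ (cong₂ (λ i y → (gain e threshold₁ i + gain e threshold₂ i) + y) (sym layer≡) (sym y≡))
                 (cong₂ (λ x₁ x₂ → 2 * threshold₁ * x₁ + 2 * threshold₂ * x₂) x₁≡ x₂≡))

    Adj⇒On : ∀ {u v} → Adj u v → On u → potential v ≤ potential u → On v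
    Adj⇒On {u} {v} adj on tight with Adj⇒Stay⊎Step {u} {v} adj
    ... | inj₂ move = Step⇒On {u} {v} move on tight
    ... | inj₁ (layer≡ , x₁≡ , x₂≡ , y≡) with on
    ... | on₁ , on₂ , on₃ =
      trans (cong₂ (λ x i → x + count e threshold₁ i) (sym x₁≡) layer≡) on₁ ,
      trans (cong₂ (λ x i → x + count e threshold₂ i) (sym x₂≡) layer≡) on₂ ,
      trans y≡ (trans on₃ (cong (λ i → srcY source + (weight e threshold₁ i + weight e threshold₂ i)) (sym layer≡)))

    On-source : On (inj₁ source)
    On-source = +-identityʳ _ , +-identityʳ _ , sym (+-identityʳ _)

  -- Coordinate ranges and the vertices along a path

  1≤σ : 1 ≤ σ
  1≤σ = n≢0⇒n>0 λ σ≡0 → <⇒≢ 1≤D (trans (sym (*-zeroʳ A)) (trans (cong (A *_) (sym σ≡0)) A*σ≡D))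

  srcX₁< : ∀ s → srcX₁ s < D + D
  srcX₁< (s₁ , _) = +-monoʳ-< D (toℕ<n s₁)

  srcX₂< : ∀ s → srcX₂ s < D + D
  srcX₂< (_ , s₂ , _) = +-monoʳ-< D (≤-trans (*-monoˡ-< σ (toℕ<n s₂)) (≤-reflexive A*σ≡D))
    where instance _ = >-nonZero 1≤σ

  D≤srcX₁ : ∀ s → D ≤ srcX₁ s
  D≤srcX₁ s = m≤m+n D _

  D≤srcX₂ : ∀ s → D ≤ srcX₂ s
  D≤srcX₂ s = m≤m+n D _

  weight≤ : ∀ t {i} → i ≤ D → weight e t i ≤ D * (2 * D)
  weight≤ t {i} i≤D = ≤-trans (prefix-≤ {c = 2 * D} slope≤ i) (*-monoˡ-≤ (2 * D) i≤D)
    where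
    slope≤ : ∀ p → below e t p * slope e p ≤ 2 * D
    slope≤ p = ≤-trans (*-mono-≤ (⟨⟩≤1 (rev e p <? t)) (slope≤2t e {D} {p} (rev-bounded e p)))
                       (≤-reflexive (*-identityˡ (2 * D)))

  module _ (π : Path) where

    private
      t₁ = threshold₁ π
      t₂ = threshold₂ π

    On⇒Step : ∀ {u v} → On π u → On π v → layer v ≡ suc (layer u) → Step u v
    On⇒Step {u} {v} (x₁u , x₂u , yu) (x₁v , x₂v , yv) layer≡ =
      layer≡ ,
      coordinate t₁ x₁u x₁v , coordinate t₂ x₂u x₂v ,
      (begin
        Y v
          ≡⟨ trans yv (cong (λ i → srcY (source π) + (weight e t₁ i + weight e t₂ i)) layer≡) ⟩
        srcY (source π) + (weight e t₁ (suc p) + weight e t₂ (suc p))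
          ≡⟨ e₁ (srcY (source π)) (weight e t₁ p) (weight e t₂ p) (below e t₁ p) (below e t₂ p) (slope e p) ⟩
        (srcY (source π) + (weight e t₁ p + weight e t₂ p)) + (below e t₁ p + below e t₂ p) * slope e p
          ≡⟨ cong₂ (λ y b → y + b * slope e p) yu (cong₂ _+_ (bit t₁ x₁u x₁v) (bit t₂ x₂u x₂v)) ⟨
        Y u + ((X₁ u ∸ X₁ v) + (X₂ u ∸ X₂ v)) * slope e p ∎)
      where
      open ≡-Reasoning
      p = layer u
      e₁ : ∀ y w₁ w₂ b₁ b₂ s → y + ((w₁ + b₁ * s) + (w₂ + b₂ * s)) ≡ (y + (w₁ + w₂)) + (b₁ + b₂) * s
      e₁ = solve-∀
      e₂ : ∀ x c b → x + (c + b) ≡ (b + x) + c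
      e₂ = solve-∀
      drop : ∀ t {x x′ s} → x + count e t p ≡ s → x′ + count e t (layer v) ≡ s → x ≡ below e t p + x′
      drop t {x} {x′} refl eq = +-cancelʳ-≡ (count e t p) _ _
        (trans (sym eq) (trans (cong (λ i → x′ + count e t i) layer≡) (e₂ x′ (count e t p) (below e t p))))
      bit : ∀ t {x x′ s} → x + count e t p ≡ s → x′ + count e t (layer v) ≡ s → x ∸ x′ ≡ below e t p
      bit t {x} {x′} q q′ = trans (cong (_∸ x′) (drop t q q′)) (m+n∸n≡m (below e t p) x′)
      coordinate : ∀ t {x x′ s} → x + count e t p ≡ s → x′ + count e t (layer v) ≡ s →
        x ∸ x′ ≤ 1 × x ≡ (x ∸ x′) + x′
      coordinate t {x} {x′} q q′ =
        ≤-trans (≤-reflexive (bit t q q′)) (⟨⟩≤1 (rev e p <? t)) ,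
        trans (drop t q q′) (cong (_+ x′) (sym (bit t q q′)))

    On⇒Stay : ∀ {u v} → On π u → On π v → layer v ≡ layer u → Stay u v
    On⇒Stay {u} {v} (x₁u , x₂u , yu) (x₁v , x₂v , yv) layer≡ =
      layer≡ , coordinate t₁ x₁u x₁v , coordinate t₂ x₂u x₂v ,
      trans yv (trans (cong (λ i → srcY (source π) + (weight e t₁ i + weight e t₂ i)) layer≡) (sym yu))
      where
      coordinate : ∀ t {x x′ s} → x + count e t (layer u) ≡ s → x′ + count e t (layer v) ≡ s → x ≡ x′
      coordinate t {x} {x′} refl eq = +-cancelʳ-≡ (count e t (layer u)) _ _
        (trans (sym eq) (cong (λ i → x′ + count e t i) layer≡))

    x₁At x₂At yAt : ℕ → ℕ
    x₁At i = srcX₁ (source π) ∸ count e t₁ i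
    x₂At i = srcX₂ (source π) ∸ count e t₂ i
    yAt i = srcY (source π) + (weight e t₁ i + weight e t₂ i)

    x₁At< : ∀ i → x₁At i < D + D
    x₁At< i = ≤-<-trans (m∸n≤m (srcX₁ (source π)) (count e t₁ i)) (srcX₁< (source π))

    x₂At< : ∀ i → x₂At i < D + D
    x₂At< i = ≤-<-trans (m∸n≤m (srcX₂ (source π)) (count e t₂ i)) (srcX₂< (source π))

    -- Accounts for the constant 5: the source contributes less than `D * D`, and each of the two
    -- weights at most twice that.
    yAt< : ∀ {i} → i ≤ D → yAt i < 5 * (D * D)
    yAt< i≤D = ≤-trans (+-mono-<-≤ (toℕ<n (proj₂ (proj₂ (source π)))) (+-mono-≤ (weight≤ t₁ i≤D) (weight≤ t₂ i≤D)))
                       (≤-reflexive (e₁ D))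
      where
      e₁ : ∀ d → d * d + (d * (2 * d) + d * (2 * d)) ≡ 5 * (d * d)
      e₁ = solve-∀

    vertexAt : ∀ i → i ≤ D → Grid
    vertexAt i i≤D = copy π , fromℕ< (s≤s i≤D) , fromℕ< (x₁At< i) , fromℕ< (x₂At< i) , fromℕ< (yAt< i≤D)

    layer-vertexAt : ∀ i (i≤D : i ≤ D) → layer (inj₂ (vertexAt i i≤D)) ≡ i
    layer-vertexAt i i≤D = toℕ-fromℕ< (s≤s i≤D)

    On-vertexAt : ∀ i (i≤D : i ≤ D) → On π (inj₂ (vertexAt i i≤D))
    On-vertexAt i i≤D =
      trans (cong₂ _+_ (toℕ-fromℕ< (x₁At< i)) (cong (count e t₁) layer≡))
            (m∸n+n≡m (≤-trans (count≤ e t₁ i) (≤-trans i≤D (D≤srcX₁ (source π))))) ,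
      trans (cong₂ _+_ (toℕ-fromℕ< (x₂At< i)) (cong (count e t₂) layer≡))
            (m∸n+n≡m (≤-trans (count≤ e t₂ i) (≤-trans i≤D (D≤srcX₂ (source π))))) ,
      trans (toℕ-fromℕ< (yAt< i≤D)) (cong yAt (sym layer≡))
      where layer≡ = layer-vertexAt i i≤D

    Adj-source : ∀ 0≤D → Adj (inj₁ (source π)) (inj₂ (vertexAt 0 0≤D))
    Adj-source 0≤D = On⇒Stay {inj₁ (source π)} {inj₂ (vertexAt 0 0≤D)} (On-source π) (On-vertexAt 0 0≤D) (layer-vertexAt 0 0≤D)

    Adj-vertexAt : ∀ i i≤D i<D → Adj (inj₂ (vertexAt i i≤D)) (inj₂ (vertexAt (suc i) i<D))
    Adj-vertexAt i i≤D i<D = refl ,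
      On⇒Step {inj₂ (vertexAt i i≤D)} {inj₂ (vertexAt (suc i) i<D)} (On-vertexAt i i≤D) (On-vertexAt (suc i) i<D)
        (trans (layer-vertexAt (suc i) i<D) (cong suc (sym (layer-vertexAt i i≤D))))

  -- Paths that share a shortcut

  record Through (π : Path) (f : Vertex × Vertex) : Set where
    constructor through
    field
      -- `long` will identify the x₂-coordinate of the source and `late` will confine the second
      -- threshold. Steps of a walk that fail either condition are charged differently in
      -- `walk-progress`.
      long : layer (proj₁ f) + 8 * A ≤ layer (proj₂ f)
      late : h + h < layer (proj₂ f)
      on-start : On π (proj₁ f)
      on-end : On π (proj₂ f)
      in-copy : InCopy (copy π) (proj₂ f)

  open Through

  Through? : ∀ π f → Dec (Through π f)
  Through? π (u , v) = map′ (λ (a , b , c , d , e) → through a b c d e)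
    (λ thr → long thr , late thr , on-start thr , on-end thr , in-copy thr)
    ((_ ≤? _) ×-dec (_ <? _) ×-dec On? π u ×-dec On? π v ×-dec InCopy? (copy π) v)

  span : Vertex × Vertex → ℕ
  span (u , v) = layer v ∸ layer u

  module _ {u v : Vertex} {π π′ : Path} (thr : Through π (u , v)) (thr′ : Through π′ (u , v)) where

    private
      8≤8A : 8 ≤ 8 * A
      8≤8A = *-monoʳ-≤ 8 1≤A
      2+u≤v : 2 + layer u ≤ layer v
      2+u≤v = ≤-trans (≤-reflexive (+-comm 2 (layer u))) (≤-trans (+-monoʳ-≤ (layer u) (≤-trans (s≤s (s≤s z≤n)) 8≤8A)) (long thr))

    -- Both paths lose the same amount of x₁ between `u` and `v`, so their counts agree on that
    -- window. Exchanging the paths bounds the opposite difference.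
    threshold₁-close : (threshold₁ π′ ∸ threshold₁ π) * (layer v ∸ layer u) < 8 * D
    threshold₁-close =
      count-separation e (layer≤D v) (<⇒≤ (toℕ<n (proj₁ (proj₁ π′)))) 2+u≤v
        (same-window {X₁ u} {X₁ v} (proj₁ (on-start thr)) (proj₁ (on-end thr)) (proj₁ (on-start thr′)) (proj₁ (on-end thr′)))

    threshold₂-close : (threshold₂ π′ ∸ threshold₂ π) * (layer v ∸ layer u) < 8 * D
    threshold₂-close =
      count-separation e (layer≤D v) (<⇒≤ (toℕ<n (proj₂ (proj₁ π′)))) 2+u≤v
        (same-window {X₂ u} {X₂ v} (x₂ (on-start thr)) (x₂ (on-end thr)) (x₂ (on-start thr′)) (x₂ (on-end thr′)))
      where
      x₂ : ∀ {A B C : Set} → A × B × C → B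
      x₂ = proj₁ ∘ proj₂

    -- Two sources differ by at least σ in x₂, whereas thresholds that the edge fails to
    -- separate are less than σ apart.
    source₂≮ : ¬ toℕ (proj₁ (proj₂ (source π))) < toℕ (proj₁ (proj₂ (source π′)))
    source₂≮ s₂<s₂′ = <⇒≱ threshold₂-close (begin
      8 * D                                                       ≡⟨ cong (8 *_) A*σ≡D ⟨
      8 * (A * σ)                                                 ≡⟨ e₁ A σ ⟩
      σ * (8 * A)                                                 ≤⟨ *-mono-≤ σ≤ (m+n≤o⇒m≤o∸n (8 * A) (subst (_≤ layer v) (+-comm (layer u) (8 * A)) (long thr))) ⟩
      (threshold₂ π′ ∸ threshold₂ π) * (layer v ∸ layer u)        ∎)
      where
      open ≤-Reasoning
      e₁ : ∀ a s → 8 * (a * s) ≡ s * (8 * a)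
      e₁ = solve-∀
      j = layer v
      s₂ = toℕ (proj₁ (proj₂ (source π)))
      s₂′ = toℕ (proj₁ (proj₂ (source π′)))
      σ≤ : σ ≤ threshold₂ π′ ∸ threshold₂ π
      -- Both paths have the same x₂ at `v`, so a gap of `σ` between the sources is a gap between
      -- the counts, and counts change no faster than thresholds.
      σ≤ = +-cancelˡ-≤ (D + s₂ * σ) _ _ (begin
        (D + s₂ * σ) + σ                                                 ≡⟨ trans (+-assoc D (s₂ * σ) σ) (cong (D +_) (+-comm (s₂ * σ) σ)) ⟩
        D + suc s₂ * σ                                                   ≤⟨ +-monoʳ-≤ D (*-monoˡ-≤ σ s₂<s₂′) ⟩
        srcX₂ (source π′)                                                ≡⟨ proj₁ (proj₂ (on-end thr′)) ⟨
        X₂ v + count e (threshold₂ π′) j                                 ≤⟨ +-monoʳ-≤ (X₂ v) (count-lipschitz e (layer≤D v) (threshold₂ π) (threshold₂ π′)) ⟩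
        X₂ v + (count e (threshold₂ π) j + (threshold₂ π′ ∸ threshold₂ π))  ≡⟨ +-assoc (X₂ v) _ _ ⟨
        (X₂ v + count e (threshold₂ π) j) + (threshold₂ π′ ∸ threshold₂ π)  ≡⟨ cong (_+ (threshold₂ π′ ∸ threshold₂ π)) (proj₁ (proj₂ (on-end thr))) ⟩
        (D + s₂ * σ) + (threshold₂ π′ ∸ threshold₂ π)                    ∎)

  Through-source₂ : ∀ {u v π π′} → Through π (u , v) → Through π′ (u , v) →
    proj₁ (proj₂ (source π)) ≡ proj₁ (proj₂ (source π′))
  Through-source₂ thr thr′ = toℕ-injective (≤-antisym
    (≮⇒≥ (source₂≮ thr′ thr)) (≮⇒≥ (source₂≮ thr thr′)))

  -- Since the sources agree in x₂, the counts already agree on the window from layer 0 to `v`. Its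
  -- length exceeds `D / 2`, and `8 D` divided by `D / 2` is 16.
  threshold₂-near : ∀ {u v π π′} → Through π (u , v) → Through π′ (u , v) → threshold₂ π′ ∸ threshold₂ π < 16
  threshold₂-near {u} {v} {π} {π′} thr thr′ = ≰⇒> λ far → <⇒≱
    (count-separation e {0} {j} (layer≤D v) (<⇒≤ (toℕ<n (proj₂ (proj₁ π′)))) 2≤j same)
    (begin
      8 * D                                          ≡⟨ trans (cong (8 *_) (sym 4*h≡D)) (e₁ h) ⟩
      16 * (h + h)                                   ≤⟨ *-mono-≤ far (<⇒≤ h+h<j) ⟩
      (threshold₂ π′ ∸ threshold₂ π) * j             ∎)
    where
    open ≤-Reasoning
    j = layer v
    e₁ : ∀ h → 8 * (4 * h) ≡ 16 * (h + h)
    e₁ = solve-∀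
    h+h<j = late thr
    2≤j : 2 ≤ j
    2≤j = ≤-trans (s≤s (s≤s z≤n)) (≤-trans (*-monoʳ-≤ 8 1≤A) (≤-trans (m≤n+m (8 * A) (layer u)) (long thr)))
    on : ∀ {π} → Through π (u , v) → X₂ v + count e (threshold₂ π) j ≡ srcX₂ (source π)
    on thr = proj₁ (proj₂ (on-end thr))
    same : 0 + count e (threshold₂ π′) j ≡ count e (threshold₂ π) j + 0
    same = trans (+-cancelˡ-≡ (X₂ v) _ _ (trans (on thr′)
      (trans (cong (λ s → D + toℕ s * σ) (sym (Through-source₂ thr thr′))) (sym (on thr))))) (sym (+-identityʳ _))

  Through-copy : ∀ {u v π π′} → Through π (u , v) → Through π′ (u , v) → copy π ≡ copy π′
  -- A source would lie in all copies, but its layer 0 contradicts `late`.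
  Through-copy {u} {inj₁ _} thr _ = contradiction (late thr) λ ()
  Through-copy {u} {inj₂ _} thr thr′ = trans (in-copy thr) (sym (in-copy thr′))

  -- With the thresholds known, the coordinates x₁ and y of the start vertex can be traced back to
  -- the source; x₂ and the copy are already determined.
  Through-injective : ∀ {u v π π′} → Through π (u , v) → Through π′ (u , v) → proj₁ π ≡ proj₁ π′ → π ≡ π′
  Through-injective {u} {v} {π} {π′} thr thr′ refl =
    cong₂ (λ s c → proj₁ π , s , c)
      (cong₂ _,_ (toℕ-injective (+-cancelˡ-≡ D _ _ (trans (sym (proj₁ on)) (proj₁ on′))))
        (cong₂ _,_ (Through-source₂ thr thr′)
          (toℕ-injective (+-cancelʳ-≡ _ _ _ (trans (sym (proj₂ (proj₂ on))) (proj₂ (proj₂ on′)))))))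
      (Through-copy thr thr′)
    where
    on = on-start thr
    on′ = on-start thr′

  -- A shortcut of span `ℓ` serves at most `16 (1 + 8 D / ℓ)` paths and saves `ℓ` on each, in all
  -- `16 (ℓ + 8 D)`, where `ℓ ≤ D`.
  load≤ : ∀ f → ∑ paths (λ π → ⟨ Through? π f ⟩ * span f) ≤ 144 * D
  load≤ f@(u , v) = ≤-trans (≤-reflexive (∑-*ʳ paths (λ π → ⟨ Through? π f ⟩) (span f)))
                            (bound (span f) refl)
    where
    open ≤-Reasoning
    bound : ∀ ℓ → span f ≡ ℓ → ∑ paths (λ π → ⟨ Through? π f ⟩) * ℓ ≤ 144 * D
    bound zero _ = ≤-trans (≤-reflexive (*-zeroʳ (∑ paths (λ π → ⟨ Through? π f ⟩)))) z≤n
    bound ℓ@(suc _) span≡ = begin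
      ∑ paths (λ π → ⟨ Through? π f ⟩) * ℓ    ≤⟨ *-monoˡ-≤ ℓ (injection⇒∑≤ (λ π → Through? π f) (enumerate-unique Fin↔Path) residue
                                               residue-injective) ⟩
      w * 16 * ℓ                              ≡⟨ e₁ ((8 * D) / ℓ) ℓ ⟩
      16 * (ℓ + (8 * D) / ℓ * ℓ)              ≤⟨ *-monoʳ-≤ 16 (+-mono-≤ (≤-trans (≤-reflexive (sym span≡)) (≤-trans (m∸n≤m (layer v) (layer u)) (layer≤D v))) (m/n*n≤m (8 * D) ℓ)) ⟩
      16 * (D + 8 * D)                        ≡⟨ e₂ D ⟩
      144 * D                                 ∎
      where
      w = suc ((8 * D) / ℓ)
      e₁ : ∀ q l → suc q * 16 * l ≡ 16 * (l + q * l)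
      e₁ = solve-∀
      e₂ : ∀ d → 16 * (d + 8 * d) ≡ 144 * d
      e₂ = solve-∀
      -- The first thresholds of these paths are less than `w` apart and the second less than 16, so
      -- residues determine both.
      residue : Path → Fin (w * 16)
      residue π = combine (fromℕ< (m%n<n (threshold₁ π) w)) (fromℕ< (m%n<n (threshold₂ π) 16))
      near₁ : ∀ {π π′} → Through π f → Through π′ f → threshold₁ π′ ∸ threshold₁ π < w
      near₁ {π} {π′} thr thr′ = m*n<o⇒m<1+o/n _ ℓ
        (subst (λ x → (threshold₁ π′ ∸ threshold₁ π) * x < 8 * D) span≡ (threshold₁-close thr thr′))
      residue-injective : ∀ {π π′} → Through π f → Through π′ f → residue π ≡ residue π′ → π ≡ π′
      residue-injective {π} {π′} thr thr′ eq with combine-injective _ _ _ _ eq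
      ... | eq₁ , eq₂ = Through-injective thr thr′ (cong₂ _,_
        (toℕ-injective (%-≡⇒≡ w (fromℕ<-injective _ _ _ _ eq₁) (near₁ thr thr′) (near₁ thr′ thr)))
        (toℕ-injective (%-≡⇒≡ 16 (fromℕ<-injective _ _ _ _ eq₂)
          (threshold₂-near thr thr′) (threshold₂-near thr′ thr))))

  -- Numbering of the vertices and the edge list

  abstract

    vertex : Fin size → Vertex
    vertex = Inverse.to Fin↔Vertex

    code : Vertex → Fin size
    code = Inverse.from Fin↔Vertex

    vertex-code : ∀ u → vertex (code u) ≡ u
    vertex-code = Inverse.strictlyInverseˡ Fin↔Vertex

    vertex-injective : ∀ {a b} → vertex a ≡ vertex b → a ≡ b
    vertex-injective = Injection.injective (↔⇒↣ Fin↔Vertex)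

    terminals : Subset size
    terminals = replicate sources inside ++ᵛ replicate grid outside

    ∣terminals∣ : ∣ terminals ∣ ≡ sources
    ∣terminals∣ = trans (∣++∣ (replicate sources inside) (replicate grid outside))
      (trans (cong₂ _+_ (∣⊤∣≡n sources) (∣⊥∣≡0 grid)) (+-identityʳ sources))

    source∈terminals : ∀ s → code (inj₁ s) ∈ₛ terminals
    source∈terminals s = lookup⇒[]= _ _ (trans (lookup-++ˡ (replicate sources inside) (replicate grid outside) i)
                                                (lookup-replicate i inside))
      where
      i : Fin sources
      i = Inverse.from Fin↔Source s

  AdjCode? : ∀ ((a , b) : Fin size × Fin size) → Dec (Adj (vertex a) (vertex b))
  AdjCode? (a , b) = Adj? (vertex a) (vertex b)

  edges : EdgeList size
  edges = filter AdjCode? (cartesianProduct (allFin size) (allFin size))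

  ∈edges⇒Adj : ∀ {a b} → (a , b) ∈ edges → Adj (vertex a) (vertex b)
  ∈edges⇒Adj ab∈ = proj₂ (∈-filter⁻ AdjCode? {xs = cartesianProduct (allFin size) (allFin size)} ab∈)

  Adj⇒∈edges : ∀ {u v} → Adj u v → (code u , code v) ∈ edges
  Adj⇒∈edges {u} {v} adj = ∈-filter⁺ AdjCode? (∈-cartesianProduct⁺ (∈-allFin (code u)) (∈-allFin (code v)))
    (subst₂ Adj (sym (vertex-code u)) (sym (vertex-code v)) adj)

  edges-unique : Unique edges
  edges-unique = filter⁺ AdjCode? (cartesianProduct⁺ (allFin⁺ size) (allFin⁺ size))

  edges-isDigraph : IsDigraph edges
  edges-isDigraph = edges-unique ,
    All.tabulate λ {(a , b)} ab∈ a≡b → Adj-irreflexive (subst (λ c → Adj (vertex a) (vertex c)) (sym a≡b) (∈edges⇒Adj ab∈))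

  -- The number of edges

  clip : ℕ → Fin 2
  clip zero = Fin.zero
  clip (suc _) = Fin.suc Fin.zero

  clip-injective : ∀ {a b} → a ≤ 1 → b ≤ 1 → clip a ≡ clip b → a ≡ b
  clip-injective z≤n z≤n _ = refl
  clip-injective (s≤s z≤n) (s≤s z≤n) _ = refl

  -- An edge out of a source is determined by its head, any other edge by its tail and two bits.
  bit₁ bit₂ : Vertex → Vertex → Fin 2
  bit₁ u v = clip (X₁ u ∸ X₁ v)
  bit₂ u v = clip (X₂ u ∸ X₂ v)

  choose : Vertex → Fin size → Fin size → Fin size ⊎ Fin (size * (2 * 2))
  choose (inj₁ _) a b = inj₁ b
  choose u@(inj₂ _) a b = inj₂ (combine a (combine (bit₁ u (vertex b)) (bit₂ u (vertex b))))

  label : Fin size × Fin size → Fin (size + size * (2 * 2))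
  label (a , b) = join size (size * (2 * 2)) (choose (vertex a) a b)

  coordinates-injective : ∀ {g g′ : Grid} → proj₁ g ≡ proj₁ g′ → layer (inj₂ g) ≡ layer (inj₂ g′) →
    X₁ (inj₂ g) ≡ X₁ (inj₂ g′) → X₂ (inj₂ g) ≡ X₂ (inj₂ g′) → Y (inj₂ g) ≡ Y (inj₂ g′) → g ≡ g′
  coordinates-injective c l x₁ x₂ y = cong₂ _,_ c (cong₂ _,_ (toℕ-injective l)
    (cong₂ _,_ (toℕ-injective x₁) (cong₂ _,_ (toℕ-injective x₂) (toℕ-injective y))))

  Adj-functional : ∀ {g v v′} → Adj (inj₂ g) v → Adj (inj₂ g) v′ →
    bit₁ (inj₂ g) v ≡ bit₁ (inj₂ g) v′ → bit₂ (inj₂ g) v ≡ bit₂ (inj₂ g) v′ → v ≡ v′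
  Adj-functional {g} {inj₂ _} {inj₂ _} (c , l , (b₁≤ , x₁) , (b₂≤ , x₂) , y) (c′ , l′ , (b₁′≤ , x₁′) , (b₂′≤ , x₂′) , y′) q₁ q₂ =
    cong inj₂ (coordinates-injective (trans (sym c) c′) (trans l (sym l′)) (target bit₁≡ x₁ x₁′) (target bit₂≡ x₂ x₂′)
      (trans y (trans (cong₂ (λ b b′ → Y (inj₂ g) + (b + b′) * slope e (layer (inj₂ g))) bit₁≡ bit₂≡) (sym y′))))
    where
    bit₁≡ = clip-injective b₁≤ b₁′≤ q₁
    bit₂≡ = clip-injective b₂≤ b₂′≤ q₂
    target : ∀ {b b′ x x₁ x₂} → b ≡ b′ → x ≡ b + x₁ → x ≡ b′ + x₂ → x₁ ≡ x₂
    target {b} refl p q = +-cancelˡ-≡ b _ _ (trans (sym p) q)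

  Adj-cofunctional : ∀ {s s′ v} → Adj (inj₁ s) v → Adj (inj₁ s′) v → s ≡ s′
  Adj-cofunctional {v = inj₂ _} (_ , x₁ , x₂ , y) (_ , x₁′ , x₂′ , y′) =
    cong₂ _,_ (toℕ-injective (+-cancelˡ-≡ D _ _ (trans x₁ (sym x₁′))))
      (cong₂ _,_ (toℕ-injective (*-cancelʳ-≡ _ _ σ (+-cancelˡ-≡ D _ _ (trans x₂ (sym x₂′)))))
        (toℕ-injective (trans (sym y) y′)))
    where instance _ = >-nonZero 1≤σ

  join-injective : ∀ m n {x y : Fin m ⊎ Fin n} → join m n x ≡ join m n y → x ≡ y
  join-injective m n {x} {y} eq = trans (sym (splitAt-join m n x)) (trans (cong (splitAt m) eq) (splitAt-join m n y))

  label-injective : ∀ {f g} → f ∈ edges → g ∈ edges → label f ≡ label g → f ≡ g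
  label-injective {a , b} {a′ , b′} f∈ g∈ eq =
    go (vertex a) (vertex a′) refl refl (∈edges⇒Adj f∈) (∈edges⇒Adj g∈) (join-injective size (size * (2 * 2)) eq)
    where
    go : ∀ u u′ → vertex a ≡ u → vertex a′ ≡ u′ → Adj u (vertex b) → Adj u′ (vertex b′) →
      choose u a b ≡ choose u′ a′ b′ → (a , b) ≡ (a′ , b′)
    go (inj₁ s) (inj₁ s′) a≡ a′≡ adj adj′ eq with inj₁-injective eq
    ... | refl = cong (_, b) (vertex-injective (trans a≡ (trans (cong inj₁ (Adj-cofunctional {v = vertex b} adj adj′)) (sym a′≡))))
    go u@(inj₂ g) u′@(inj₂ g′) a≡ a′≡ adj adj′ eq with combine-injective a (combine (bit₁ u (vertex b)) (bit₂ u (vertex b)))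
      a′ (combine (bit₁ u′ (vertex b′)) (bit₂ u′ (vertex b′))) (inj₂-injective eq)
    ... | refl , bits with inj₂-injective (trans (sym a≡) a′≡) | combine-injective (bit₁ u (vertex b)) _ (bit₁ u′ (vertex b′)) _ bits
    ... | refl | q₁ , q₂ = cong (a ,_) (vertex-injective (Adj-functional adj adj′ q₁ q₂))
    go (inj₁ _) (inj₂ _) _ _ _ _ ()
    go (inj₂ _) (inj₁ _) _ _ _ _ ()

  -- Reduces shortcut sets measured against the edges to those measured against the vertices, at the
  -- price of a factor 5: one label per head for edges out of sources, four per tail for the others.
  length-edges≤ : length edges ≤ 5 * size
  length-edges≤ = ≤-trans (injection⇒length≤ edges-unique label label-injective) (≤-reflexive (e₁ size))
    where
    e₁ : ∀ s → s + s * (2 * 2) ≡ 5 * s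
    e₁ = solve-∀

  -- Walks in the network

  module _ (π : Path) where

    walk⇒potential≤ : ∀ {a b k} → Walk edges a b k → potential π (vertex a) ≤ potential π (vertex b)
    walk⇒potential≤ here = ≤-refl
    walk⇒potential≤ (step aw∈ walk) = ≤-trans (Adj⇒potential≤ π (∈edges⇒Adj aw∈)) (walk⇒potential≤ walk)

    -- The potential never falls along a walk; if it does not rise overall, every edge is tight and
    -- none can leave the path.
    walk⇒On : ∀ {a b k} → Walk edges a b k → On π (vertex a) → potential π (vertex b) ≤ potential π (vertex a) → On π (vertex b)
    walk⇒On here on _ = on
    walk⇒On {a} {b} (step {w = w} aw∈ walk) on tight =
      walk⇒On walk (Adj⇒On π adj on (≤-trans (walk⇒potential≤ walk) tight)) (≤-trans tight (Adj⇒potential≤ π adj))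
      where adj = ∈edges⇒Adj aw∈

  walk⇒layer≤ : ∀ {a b k} → Walk edges a b k → layer (vertex a) ≤ layer (vertex b)
  walk⇒layer≤ here = ≤-refl
  walk⇒layer≤ (step {a} {w} aw∈ walk) = ≤-trans (Adj⇒layer≤ {vertex a} {vertex w} (∈edges⇒Adj aw∈)) (walk⇒layer≤ walk)

  walk⇒InCopy : ∀ {c a b k} → Walk edges a b k → InCopy c (vertex b) → InCopy c (vertex a)
  walk⇒InCopy here inc = inc
  walk⇒InCopy (step aw∈ walk) inc = Adj⇒InCopy (∈edges⇒Adj aw∈) (walk⇒InCopy walk inc)

  -- Walks that use shortcuts

  module _ (H : EdgeList size) (shortcut : IsShortcutSet edges H) where

    ends : Fin size × Fin size → Vertex × Vertex
    ends (a , b) = vertex a , vertex b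

    -- Every arc stands for a walk of original edges, so monotonicity of the potential and of the
    -- layers carries over to shortcuts.
    arc⇒reachable : ∀ {a b} → (a , b) ∈ edges ++ H → Reachable edges a b
    arc⇒reachable ab∈ with ∈-++⁻ edges ab∈
    ... | inj₁ ab∈E = 1 , step ab∈E here
    ... | inj₂ ab∈H = proj₂ (All.lookup (proj₂ shortcut) ab∈H)

    cost : Path → ℕ
    cost π = ∑ H λ f → ⟨ Through? π (ends f) ⟩ * span (ends f)

    total-cost≤ : ∑ paths cost ≤ length H * (144 * D)
    total-cost≤ = ≤-trans
      (≤-reflexive (∑-swap paths H λ π f → ⟨ Through? π (ends f) ⟩ * span (ends f)))
      (∑-≤ H λ f → load≤ (ends f))

    -- Averaging over the paths: a total cost below `pathCount * h` leaves some path below `h`.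
    cheap-path : length H * (144 * D) < pathCount * h → ∃[ π ] cost π < h
    cheap-path few = ∑-pigeonhole paths (≤-<-trans total-cost≤
      (subst (λ m → length H * (144 * D) < m * h) (sym (length-enumerate Fin↔Path)) few))

    module _ (π : Path) where

      -- The part of the span lying below layer `x`. Summed over `H` it is monotone in `x`, rises by
      -- the full span across a shortcut through the path, and never exceeds the cost; so the jumps
      -- of one walk are not counted twice.
      skipped : ℕ → Fin size × Fin size → ℕ
      skipped x (a , b) = ⟨ Through? π (ends (a , b)) ⟩ * ((x ⊓ layer (vertex b)) ∸ layer (vertex a))

      progress : ℕ → ℕ
      progress x = ∑ H (skipped x)

      skipped-mono : ∀ {x y} → x ≤ y → ∀ f → skipped x f ≤ skipped y f
      skipped-mono x≤y (a , b) = *-monoʳ-≤ ⟨ Through? π (ends (a , b)) ⟩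
        (∸-monoˡ-≤ (layer (vertex a)) (⊓-monoˡ-≤ (layer (vertex b)) x≤y))

      progress-mono : ∀ {x y} → x ≤ y → progress x ≤ progress y
      progress-mono x≤y = ∑-mono H (skipped-mono x≤y)

      progress≤cost : ∀ x → progress x ≤ cost π
      progress≤cost x = ∑-mono H λ (a , b) → *-monoʳ-≤ ⟨ Through? π (ends (a , b)) ⟩
        (∸-monoˡ-≤ (layer (vertex a)) (m⊓n≤n x (layer (vertex b))))

      progress-jump : ∀ {a b} → (a , b) ∈ H → layer (vertex a) ≤ layer (vertex b) → Through π (vertex a , vertex b) →
        progress (layer (vertex a)) + (layer (vertex b) ∸ layer (vertex a)) ≤ progress (layer (vertex b))
      progress-jump {a} {b} ab∈ i≤j thr = ∑-mono-+ (j ∸ i) (skipped-mono i≤j) ab∈ (≤-reflexive (begin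
        ⟨ Through? π (ends (a , b)) ⟩ * ((i ⊓ j) ∸ i) + (j ∸ i)   ≡⟨ cong (λ x → x * ((i ⊓ j) ∸ i) + (j ∸ i)) one ⟩
        1 * ((i ⊓ j) ∸ i) + (j ∸ i)                               ≡⟨ cong (λ x → 1 * x + (j ∸ i)) (m≤n⇒m∸n≡0 (m⊓n≤m i j)) ⟩
        j ∸ i                                                     ≡⟨ cong (_∸ i) (⊓-idem j) ⟨
        (j ⊓ j) ∸ i                                               ≡⟨ *-identityˡ _ ⟨
        1 * ((j ⊓ j) ∸ i)                                         ≡⟨ cong (_* ((j ⊓ j) ∸ i)) one ⟨
        ⟨ Through? π (ends (a , b)) ⟩ * ((j ⊓ j) ∸ i)             ∎))
        where
        open ≡-Reasoning
        i = layer (vertex a)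
        j = layer (vertex b)
        one = ⟨⟩≡1 (Through? π (ends (a , b))) thr

      walk⇒potential≤⁺ : ∀ {a b k} → Walk (edges ++ H) a b k → potential π (vertex a) ≤ potential π (vertex b)
      walk⇒potential≤⁺ here = ≤-refl
      walk⇒potential≤⁺ (step aw∈ walk) = ≤-trans (walk⇒potential≤ π (proj₂ (arc⇒reachable aw∈))) (walk⇒potential≤⁺ walk)

      walk⇒InCopy⁺ : ∀ {c a b k} → Walk (edges ++ H) a b k → InCopy c (vertex b) → InCopy c (vertex a)
      walk⇒InCopy⁺ here inc = inc
      walk⇒InCopy⁺ (step aw∈ walk) inc = walk⇒InCopy (proj₂ (arc⇒reachable aw∈)) (walk⇒InCopy⁺ walk inc)

      -- A step ending in the first half of the layers, or spanning at most 8A layers, is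
      -- absorbed by m resp. k * (8 * A); any other step is a shortcut through π.
      walk-progress : ∀ {a b k} → Walk (edges ++ H) a b k → On π (vertex a) → On π (vertex b) → InCopy (copy π) (vertex b) →
        ∀ m → layer (vertex a) ≤ m → h + h ≤ m →
        layer (vertex b) + progress (layer (vertex a)) ≤ m + k * (8 * A) + progress (layer (vertex b))
      walk-progress {a} here _ _ _ m a≤m _ = +-monoˡ-≤ _ (≤-trans a≤m (m≤m+n m 0))
      walk-progress {a} {b} {suc k} (step {w = w} aw∈ walk) on-a on-b inc m a≤m half≤m = cases
        where
        open ≤-Reasoning
        reach = proj₂ (arc⇒reachable aw∈)
        i = layer (vertex a)
        l = layer (vertex w)
        j = layer (vertex b)
        L = 8 * A
        i≤l : i ≤ l
        i≤l = walk⇒layer≤ reach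
        -- Both ends of the walk have the potential of the path, so the potential cannot have risen
        -- at `w`.
        on-w : On π (vertex w)
        on-w = walk⇒On π reach on-a (≤-trans (walk⇒potential≤⁺ walk)
          (≤-reflexive (trans (On⇒potential π {vertex b} on-b) (sym (On⇒potential π {vertex a} on-a)))))
        rest = walk-progress walk on-w on-b inc
        cases : j + progress i ≤ m + suc k * L + progress j
        cases with l ≤? h + h | l ≤? i + L
        ... | yes early | _ = begin
            j + progress i                  ≤⟨ +-monoʳ-≤ j (progress-mono i≤l) ⟩
            j + progress l                  ≤⟨ rest m (≤-trans early half≤m) half≤m ⟩
            m + k * L + progress j          ≤⟨ +-monoˡ-≤ (progress j) (+-monoʳ-≤ m (m≤n+m (k * L) L)) ⟩
            m + suc k * L + progress j      ∎
        ... | no _ | yes short = begin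
            j + progress i                  ≤⟨ +-monoʳ-≤ j (progress-mono i≤l) ⟩
            j + progress l                  ≤⟨ rest (m + L) (≤-trans short (+-monoˡ-≤ L a≤m)) (≤-trans half≤m (m≤m+n m L)) ⟩
            m + L + k * L + progress j      ≡⟨ cong (_+ progress j) (+-assoc m L (k * L)) ⟩
            m + suc k * L + progress j      ∎
        ... | no late | no long = +-cancelʳ-≤ (l ∸ i) _ _ (begin
            j + progress i + (l ∸ i)                   ≡⟨ +-assoc j _ _ ⟩
            j + (progress i + (l ∸ i))                 ≤⟨ +-monoʳ-≤ j (progress-jump aw∈H i≤l thr) ⟩
            j + progress l                             ≤⟨ rest (m + (l ∸ i)) l≤ (≤-trans half≤m (m≤m+n m _)) ⟩
            m + (l ∸ i) + k * L + progress j           ≡⟨ e₁ m (l ∸ i) (k * L) (progress j) ⟩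
            m + k * L + progress j + (l ∸ i)           ≤⟨ +-monoˡ-≤ (l ∸ i) (+-monoˡ-≤ (progress j) (+-monoʳ-≤ m (m≤n+m (k * L) L))) ⟩
            m + suc k * L + progress j + (l ∸ i)       ∎)
          where
          e₁ : ∀ m x k p → m + x + k + p ≡ m + k + p + x
          e₁ = solve-∀
          l≤ : l ≤ m + (l ∸ i)
          l≤ = ≤-trans (≤-reflexive (sym (m+[n∸m]≡n i≤l))) (+-monoˡ-≤ (l ∸ i) a≤m)
          -- An original edge advances by at most one layer and so is never longer than `8 * A`.
          aw∈H : (a , w) ∈ H
          aw∈H with ∈-++⁻ edges aw∈
          ... | inj₂ p = p
          ... | inj₁ p = contradiction (≤-trans (Adj⇒layer≤1+ {vertex a} {vertex w} (∈edges⇒Adj p))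
                  (≤-trans (≤-reflexive (+-comm 1 i)) (+-monoʳ-≤ i (≤-trans 1≤A (m≤m+n A _))))) long
          thr : Through π (vertex a , vertex w)
          thr = through (<⇒≤ (≰⇒> long)) (≰⇒> late) on-a on-w (walk⇒InCopy⁺ walk inc)

      origin target : Fin size
      origin = code (inj₁ (source π))
      target = code (inj₂ (vertexAt π D ≤-refl))

      path-reachable : Reachable (edges ++ H) origin target
      path-reachable = _ , walkTo D ≤-refl
        where
        walkTo : ∀ i (i≤D : i ≤ D) → Walk (edges ++ H) origin (code (inj₂ (vertexAt π i i≤D))) (suc i)
        walkTo zero 0≤D = step (∈-++⁺ˡ (Adj⇒∈edges {inj₁ (source π)} (Adj-source π 0≤D))) here
        walkTo (suc i) i<D = snoc (walkTo i (<⇒≤ i<D)) (∈-++⁺ˡ (Adj⇒∈edges (Adj-vertexAt π i (<⇒≤ i<D) i<D)))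

      -- Of the `4 h` layers to be crossed, the first half is conceded and the shortcuts through the
      -- path cover fewer than `h`; the rest takes `k` steps of at most `8 * A` layers each.
      path-long : cost π < h → ∀ k → Walk (edges ++ H) origin target k → h < k * (8 * A)
      path-long cheap k walk = +-cancelʳ-< (h + h + h) _ _ (begin-strict
        h + (h + h + h)                                    ≡⟨ trans (e₁ h) 4*h≡D ⟩
        D                                                  ≡⟨ layer-target ⟨
        layer (vertex target)                              ≤⟨ m≤m+n _ _ ⟩
        layer (vertex target) + progress (layer (vertex origin))
          ≤⟨ walk-progress walk on-origin on-target in-target (h + h) (≤-trans (≤-reflexive layer-origin) z≤n) ≤-refl ⟩
        h + h + k * (8 * A) + progress (layer (vertex target))
          <⟨ +-monoʳ-< (h + h + k * (8 * A)) (≤-<-trans (progress≤cost _) cheap) ⟩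
        h + h + k * (8 * A) + h                            ≡⟨ e₂ (h + h) (k * (8 * A)) h ⟩
        k * (8 * A) + (h + h + h)                          ∎)
        where
        open ≤-Reasoning
        e₁ : ∀ h → h + (h + h + h) ≡ 4 * h
        e₁ = solve-∀
        e₂ : ∀ a k h → a + k + h ≡ k + (a + h)
        e₂ = solve-∀
        origin≡ = vertex-code (inj₁ (source π))
        target≡ = vertex-code (inj₂ (vertexAt π D ≤-refl))
        layer-origin : layer (vertex origin) ≡ 0
        layer-origin = cong layer origin≡
        layer-target : layer (vertex target) ≡ D
        layer-target = trans (cong layer target≡) (layer-vertexAt π D ≤-refl)
        on-origin : On π (vertex origin)
        on-origin = subst (On π) (sym origin≡) (On-source π)
        on-target : On π (vertex target)
        on-target = subst (On π) (sym target≡) (On-vertexAt π D ≤-refl)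
        in-target : InCopy (copy π) (vertex target)
        in-target = subst (InCopy (copy π)) (sym target≡) refl

    long-distance : length H * (144 * D) < pathCount * h →
      Σ[ s ∈ Fin size ] Σ[ t ∈ Fin size ] s ∈ₛ terminals × Reachable (edges ++ H) s t ×
        (∀ k → Walk (edges ++ H) s t k → h < k * (8 * A))
    long-distance few with cheap-path few
    ... | π , cheap = origin π , target π , source∈terminals (source π) , path-reachable π , path-long π cheap

-- Rational bounds

toℚᵘ-⟦⟧ : ∀ n → toℚᵘ ⟦ n ⟧ ≃ mkℚᵘ (ℤ.+ n) 0
toℚᵘ-⟦⟧ n = ℚ.toℚᵘ-fromℚᵘ (mkℚᵘ (ℤ.+ n) 0)

⟦⟧-mono-≤ : ∀ {m n} → m ≤ n → ⟦ m ⟧ ≤ℚ ⟦ n ⟧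
⟦⟧-mono-≤ {m} {n} m≤n = ℚ.toℚᵘ-cancel-≤
  (ℚᵘ.≤-respˡ-≃ (ℚᵘ.≃-sym (toℚᵘ-⟦⟧ m)) (ℚᵘ.≤-respʳ-≃ (ℚᵘ.≃-sym (toℚᵘ-⟦⟧ n))
    (*≤* (ℤ.*-monoʳ-≤-nonNeg (ℤ.+ 1) (ℤ.+≤+ m≤n)))))

⟦⟧-cancel-≤ : ∀ {m n} → ⟦ m ⟧ ≤ℚ ⟦ n ⟧ → m ≤ n
⟦⟧-cancel-≤ {m} {n} m≤n = ℤ.drop‿+≤+ (subst₂ ℤ._≤_ (ℤ.*-identityʳ (ℤ.+ m)) (ℤ.*-identityʳ (ℤ.+ n)) (ℚᵘ.drop-*≤*
  (ℚᵘ.≤-respˡ-≃ (toℚᵘ-⟦⟧ m) (ℚᵘ.≤-respʳ-≃ (toℚᵘ-⟦⟧ n) (ℚ.toℚᵘ-mono-≤ m≤n)))))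

⟦⟧-* : ∀ m n → ⟦ m * n ⟧ ≡ ⟦ m ⟧ *ℚ ⟦ n ⟧
⟦⟧-* m n = ℚ.toℚᵘ-injective (begin
  toℚᵘ ⟦ m * n ⟧                       ≈⟨ toℚᵘ-⟦⟧ (m * n) ⟩
  mkℚᵘ (ℤ.+ (m * n)) 0                   ≡⟨ cong (λ i → mkℚᵘ i 0) (ℤ.pos-* m n) ⟩
  mkℚᵘ (ℤ.+ m) 0 ℚᵘ.* mkℚᵘ (ℤ.+ n) 0       ≈⟨ ℚᵘ.*-cong (toℚᵘ-⟦⟧ m) (toℚᵘ-⟦⟧ n) ⟨
  toℚᵘ ⟦ m ⟧ ℚᵘ.* toℚᵘ ⟦ n ⟧           ≈⟨ ℚ.toℚᵘ-homo-* ⟦ m ⟧ ⟦ n ⟧ ⟨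
  toℚᵘ (⟦ m ⟧ *ℚ ⟦ n ⟧)                ∎)
  where open import Relation.Binary.Reasoning.Setoid ℚᵘ.≃-setoid

⟦⟧-^ : ∀ m k → ⟦ m ^ k ⟧ ≡ ⟦ m ⟧ ^ℚ k
⟦⟧-^ m zero = refl
⟦⟧-^ m (suc k) = trans (⟦⟧-* m (m ^ k)) (cong (⟦ m ⟧ *ℚ_) (⟦⟧-^ m k))

^ℚ-distribʳ-* : ∀ k p q → (p *ℚ q) ^ℚ k ≡ (p ^ℚ k) *ℚ (q ^ℚ k)
^ℚ-distribʳ-* zero p q = refl
^ℚ-distribʳ-* (suc k) p q = begin
  (p *ℚ q) *ℚ ((p *ℚ q) ^ℚ k)              ≡⟨ cong ((p *ℚ q) *ℚ_) (^ℚ-distribʳ-* k p q) ⟩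
  (p *ℚ q) *ℚ ((p ^ℚ k) *ℚ (q ^ℚ k))       ≡⟨ ℚ-CS.interchange p q (p ^ℚ k) (q ^ℚ k) ⟩
  (p *ℚ (p ^ℚ k)) *ℚ (q *ℚ (q ^ℚ k))       ∎
  where
  open ≡-Reasoning

^ℚ-nonNegative : ∀ k p → NonNegative p → NonNegative (p ^ℚ k)
^ℚ-nonNegative zero p _ = _
^ℚ-nonNegative (suc k) p nn = ℚ.nonNeg*nonNeg⇒nonNeg p {{nn}} (p ^ℚ k) {{^ℚ-nonNegative k p nn}}

^ℚ-1 : ∀ k → 1ℚ ^ℚ k ≡ 1ℚ
^ℚ-1 zero = refl
^ℚ-1 (suc k) = trans (ℚ.*-identityˡ (1ℚ ^ℚ k)) (^ℚ-1 k)

-- Lets a natural number stand in for the rational constant that bounds the shortcut set.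
≤⟦numerator⟧ : ∀ q → Positive q → q ≤ℚ ⟦ ∣ ↥ q ∣ℤ ⟧
≤⟦numerator⟧ q@(mkℚ +[1+ m ] d _) _ = ℚ.toℚᵘ-cancel-≤ (ℚᵘ.≤-respʳ-≃ (ℚᵘ.≃-sym (toℚᵘ-⟦⟧ (suc m)))
  (*≤* (subst₂ ℤ._≤_ (ℤ.pos-* (suc m) 1) (ℤ.pos-* (suc m) (suc d)) (ℤ.+≤+ (*-monoʳ-≤ (suc m) (s≤s z≤n))))))

scaled-bound : ∀ {q B n ℓ} k → NonNegative q → q *ℚ ⟦ B ⟧ ≡ 1ℚ → n ≤ (B * ℓ) ^ k → (q ^ℚ k) *ℚ ⟦ n ⟧ ≤ℚ (⟦ ℓ ⟧ ^ℚ k)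
scaled-bound {q} {B} {n} {ℓ} k q≥0 q*B≡1 n≤ = begin
  (q ^ℚ k) *ℚ ⟦ n ⟧                           ≤⟨ ℚ.*-monoˡ-≤-nonNeg (q ^ℚ k) {{^ℚ-nonNegative k q q≥0}} (⟦⟧-mono-≤ n≤) ⟩
  (q ^ℚ k) *ℚ ⟦ (B * ℓ) ^ k ⟧                 ≡⟨ cong ((q ^ℚ k) *ℚ_) (trans (⟦⟧-^ (B * ℓ) k) (cong (_^ℚ k) (⟦⟧-* B ℓ))) ⟩
  (q ^ℚ k) *ℚ ((⟦ B ⟧ *ℚ ⟦ ℓ ⟧) ^ℚ k)         ≡⟨ ^ℚ-distribʳ-* k q (⟦ B ⟧ *ℚ ⟦ ℓ ⟧) ⟨
  (q *ℚ (⟦ B ⟧ *ℚ ⟦ ℓ ⟧)) ^ℚ k                ≡⟨ cong (_^ℚ k) (trans (sym (ℚ.*-assoc q ⟦ B ⟧ ⟦ ℓ ⟧)) (trans (cong (_*ℚ ⟦ ℓ ⟧) q*B≡1) (ℚ.*-identityˡ ⟦ ℓ ⟧))) ⟩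
  ⟦ ℓ ⟧ ^ℚ k                                  ∎
  where open ℚ.≤-Reasoning

≤-scaled : ∀ {q m n} → Positive q → ⟦ m ⟧ ≤ℚ q *ℚ ⟦ n ⟧ → m ≤ ∣ ↥ q ∣ℤ * n
≤-scaled {q} {m} {n} q>0 m≤ = ⟦⟧-cancel-≤ (begin
  ⟦ m ⟧                          ≤⟨ m≤ ⟩
  q *ℚ ⟦ n ⟧                     ≤⟨ ℚ.*-monoʳ-≤-nonNeg ⟦ n ⟧ {{ℚ.normalize-nonNeg n 1}} (≤⟦numerator⟧ q q>0) ⟩
  ⟦ ∣ ↥ q ∣ℤ ⟧ *ℚ ⟦ n ⟧           ≡⟨ ⟦⟧-* ∣ ↥ q ∣ℤ n ⟨
  ⟦ ∣ ↥ q ∣ℤ * n ⟧                ∎)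
  where open ℚ.≤-Reasoning

-- Powers and the size of the source set

n<2^n : ∀ n → n < 2 ^ n
n<2^n zero = s≤s z≤n
n<2^n (suc n) = begin-strict
  suc n              ≡⟨ +-comm 1 n ⟩
  n + 1              <⟨ +-mono-<-≤ (n<2^n n) (m^n>0 2 n) ⟩
  2 ^ n + 2 ^ n      ≡⟨ cong (2 ^ n +_) (+-identityʳ (2 ^ n)) ⟨
  2 ^ suc n          ∎
  where open ≤-Reasoning

^-distribʳ-* : ∀ k m n → (m * n) ^ k ≡ m ^ k * n ^ k
^-distribʳ-* zero m n = refl
^-distribʳ-* (suc k) m n = trans (cong (m * n *_) (^-distribʳ-* k m n)) (*-CS.interchange m n (m ^ k) (n ^ k))

^-swap : ∀ m j k → (m ^ j) ^ k ≡ (m ^ k) ^ j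
^-swap m j k = trans (^-*-assoc m j k) (trans (cong (m ^_) (*-comm j k)) (sym (^-*-assoc m k j)))

m≤m^1+k : ∀ m k → 1 ≤ m → m ≤ m ^ suc k
m≤m^1+k m k 1≤m = ≤-trans (≤-reflexive (sym (*-identityʳ m))) (*-monoʳ-≤ m (m^n>0 m {{>-nonZero 1≤m}} k))

-- As `n` is within a factor `b` of `D ^ (d + 3)`, and `A` is bounded, a constant `K` with
-- logarithmic exponent 0 suffices.
sizeTildeTheta : ∀ {d K n s D} b A → n ≤ b * D ^ (d + 3) → D ^ (d + 3) ≤ n → s ≡ A * D ^ 3 → 1 ≤ A →
  b ^ 3 ≤ K → A ≤ K → 1 ≤ K → SizeTildeTheta d K 0 n s
sizeTildeTheta {d} {K} {n} {s} {D} b A n≤ ≤n refl 1≤A b³≤K A≤K 1≤K = upper , lower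
  where
  open ≤-Reasoning
  p = d + 3
  K≤K^p : K ≤ K ^ p
  K≤K^p = subst (λ x → K ≤ K ^ x) (+-comm 3 d) (m≤m^1+k K (2 + d) 1≤K)
  upper : n ^ 3 ≤ (A * D ^ 3 * (K * 1)) ^ p
  upper = begin
    n ^ 3                            ≤⟨ ^-monoˡ-≤ 3 n≤ ⟩
    (b * D ^ p) ^ 3                  ≡⟨ ^-distribʳ-* 3 b (D ^ p) ⟩
    b ^ 3 * (D ^ p) ^ 3              ≤⟨ *-mono-≤ (≤-trans b³≤K K≤K^p) (≤-reflexive (^-swap D p 3)) ⟩
    K ^ p * (D ^ 3) ^ p              ≡⟨ ^-distribʳ-* p K (D ^ 3) ⟨
    (K * D ^ 3) ^ p                  ≤⟨ ^-monoˡ-≤ p (*-monoˡ-≤ (D ^ 3) (≤-trans (≤-reflexive (sym (*-identityˡ K))) (*-monoˡ-≤ K 1≤A))) ⟩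
    (A * K * D ^ 3) ^ p              ≡⟨ cong (_^ p) (e₁ A K (D ^ 3)) ⟩
    (A * D ^ 3 * (K * 1)) ^ p        ∎
    where
    e₁ : ∀ a k x → a * k * x ≡ a * x * (k * 1)
    e₁ = solve-∀
  lower : (A * D ^ 3) ^ p ≤ n ^ 3 * (K * 1) ^ p
  lower = begin
    (A * D ^ 3) ^ p                  ≡⟨ ^-distribʳ-* p A (D ^ 3) ⟩
    A ^ p * (D ^ 3) ^ p              ≡⟨ cong (A ^ p *_) (^-swap D 3 p) ⟩
    A ^ p * (D ^ p) ^ 3              ≤⟨ *-mono-≤ (^-monoˡ-≤ p (≤-trans A≤K (≤-reflexive (sym (*-identityʳ K))))) (^-monoˡ-≤ 3 ≤n) ⟩
    (K * 1) ^ p * n ^ 3              ≡⟨ *-comm ((K * 1) ^ p) (n ^ 3) ⟩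
    n ^ 3 * (K * 1) ^ p              ∎

-- Choice of the parameters

module Instance (b : ℕ) (41≤b : 41 ≤ b) (d M N : ℕ) where

  -- Here d is two less than in the theorem.  The number of vertices is at most b D^(d+5), and
  -- 576 = 4 · 144 comes from load≤.
  α = M * (b * 576)
  A = 2 ^ α
  -- `N` makes the instances arbitrarily large while `A` stays fixed; the 2 makes `D` four times
  -- `h`.
  e = α + (2 + N)
  σ = 2 ^ (2 + N)
  h = 2 ^ (α + N)
  Q = (2 ^ e) ^ d

  1≤A : 1 ≤ A
  1≤A = m^n>0 2 α

  A*σ≡D : A * σ ≡ 2 ^ e
  A*σ≡D = sym (^-distribˡ-+-* 2 α (2 + N))

  4*h≡D : 4 * h ≡ 2 ^ e
  4*h≡D = trans (sym (^-distribˡ-+-* 2 2 (α + N))) (cong (2 ^_) (e₁ α N))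
    where
    e₁ : ∀ a n → 2 + (a + n) ≡ a + (2 + n)
    e₁ = solve-∀

  open Network e A σ h Q 1≤A A*σ≡D 4*h≡D

  instance
    D≢0 : NonZero D
    D≢0 = m^n≢0 2 e

  1≤Q : 1 ≤ Q
  1≤Q = m^n>0 D d

  scale : ℕ
  scale = Q * (D * (D * (D * (D * D))))

  scale≡ : scale ≡ D ^ (2 + d + 3)
  scale≡ = trans (e₁ Q D) (cong (λ x → D * (D * x)) (sym (^-distribˡ-+-* D d 3)))
    where
    e₁ : ∀ q x → q * (x * (x * (x * (x * x)))) ≡ x * (x * (q * (x * (x * (x * 1)))))
    e₁ = solve-∀

  1≤b : 1 ≤ b
  1≤b = ≤-trans (s≤s z≤n) 41≤b

  size≤ : size ≤ b * scale
  size≤ = begin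
    D * (A * (D * D)) + grid                                          ≤⟨ +-mono-≤ sources≤ grid≤ ⟩
    -- The source of 41: at most `scale` sources, and the grid with `suc D` replaced by `D + D`
    -- contributes `2 * 2 * 2 * 5 = 40` times `scale`.
    scale + Q * ((D + D) * ((D + D) * ((D + D) * (5 * (D * D)))))     ≡⟨ e₁ Q D ⟩
    41 * scale                                                        ≤⟨ *-monoˡ-≤ scale 41≤b ⟩
    b * scale                                                         ∎
    where
    open ≤-Reasoning
    e₁ : ∀ q x → q * (x * (x * (x * (x * x)))) + q * ((x + x) * ((x + x) * ((x + x) * (5 * (x * x))))) ≡ 41 * (q * (x * (x * (x * (x * x)))))
    e₁ = solve-∀
    e₂ : ∀ x → x * (x * (x * x)) ≡ 1 * (x * (x * (x * (x * 1))))
    e₂ = solve-∀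
    A≤D : A ≤ D
    A≤D = ^-monoʳ-≤ 2 (m≤m+n α (2 + N))
    sources≤ : sources ≤ scale
    sources≤ = begin
      D * (A * (D * D))                    ≤⟨ *-monoʳ-≤ D (*-monoˡ-≤ (D * D) A≤D) ⟩
      D * (D * (D * D))                    ≡⟨ e₂ D ⟩
      1 * (D * (D * (D * (D * 1))))        ≤⟨ *-mono-≤ 1≤Q (*-monoʳ-≤ D (*-monoʳ-≤ D (*-monoʳ-≤ D (*-monoʳ-≤ D 1≤D)))) ⟩
      scale                                ∎
    grid≤ : grid ≤ Q * ((D + D) * ((D + D) * ((D + D) * (5 * (D * D)))))
    grid≤ = *-monoʳ-≤ Q (*-monoˡ-≤ ((D + D) * ((D + D) * (5 * (D * D)))) (+-monoˡ-≤ D 1≤D))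

  scale≤size : scale ≤ size
  scale≤size = ≤-trans (*-monoʳ-≤ Q (*-mono-≤ (n≤1+n D) (*-mono-≤ (m≤m+n D D) (*-mono-≤ (m≤m+n D D) (m≤m+n (D * D) _)))))
                       (m≤n+m grid sources)

  N≤size : N ≤ size
  N≤size = begin
    N                                    ≤⟨ <⇒≤ (n<2^n N) ⟩
    2 ^ N                                ≤⟨ ^-monoʳ-≤ 2 (≤-trans (m≤n+m N 2) (m≤n+m (2 + N) α)) ⟩
    D                                    ≡⟨ e₁ D ⟩
    1 * (D * (1 * (1 * (1 * 1))))        ≤⟨ *-mono-≤ 1≤Q (*-monoʳ-≤ D (*-mono-≤ 1≤D (*-mono-≤ 1≤D (*-mono-≤ 1≤D 1≤D)))) ⟩
    scale                                ≤⟨ scale≤size ⟩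
    size                                 ∎
    where
    open ≤-Reasoning
    e₁ : ∀ x → x ≡ 1 * (x * (1 * (1 * (1 * 1))))
    e₁ = solve-∀

  1≤scale : 1 ≤ scale
  1≤scale = *-mono-≤ 1≤Q (*-mono-≤ 1≤D (*-mono-≤ 1≤D (*-mono-≤ 1≤D (*-mono-≤ 1≤D 1≤D))))

  sources≡ : sources ≡ A * D ^ 3
  sources≡ = e₁ D A
    where
    e₁ : ∀ x a → x * (a * (x * x)) ≡ a * (x * (x * (x * 1)))
    e₁ = solve-∀

  -- There are `A * scale` paths, so after cancelling `scale * D` the claim is `α < A`; this is why
  -- `A` is exponential in `α`.
  few : ∀ {m} → m ≤ M * size → m * (144 * D) < pathCount * h
  few {m} m≤ = *-cancelˡ-< 4 _ _ (begin-strict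
    4 * (m * (144 * D))                      ≡⟨ e₁ m D ⟩
    m * (576 * D)                            ≤⟨ *-monoˡ-≤ (576 * D) (≤-trans m≤ (*-monoʳ-≤ M size≤)) ⟩
    M * (b * scale) * (576 * D)              ≡⟨ e₂ M b scale 576 D ⟩
    α * (scale * D)                          <⟨ *-monoˡ-< (scale * D) {{>-nonZero (*-mono-≤ 1≤scale 1≤D)}} (n<2^n α) ⟩
    A * (scale * D)                          ≡⟨ e₃ A Q D D ⟩
    D * pathCount                            ≡⟨ cong (_* pathCount) 4*h≡D ⟨
    4 * h * pathCount                        ≡⟨ trans (*-assoc 4 h pathCount) (cong (4 *_) (*-comm h pathCount)) ⟩
    4 * (pathCount * h)                      ∎)
    where
    open ≤-Reasoning
    e₁ : ∀ m x → 4 * (m * (144 * x)) ≡ m * (576 * x)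
    e₁ = solve-∀
    e₂ : ∀ m a s b x → m * (a * s) * (b * x) ≡ m * (a * b) * (s * x)
    e₂ = solve-∀
    e₃ : ∀ a q x y → a * (q * (x * (x * (x * (x * x)))) * y) ≡ y * ((x * x) * ((x * (a * (x * x))) * q))
    e₃ = solve-∀

  -- Combines `size ≤ b * D ^ p` with `D = 4 h ≤ 32 A k`; the factor in front of `k` becomes the
  -- reciprocal of the constant `c`.
  size≤power : ∀ {k} → h < k * (8 * A) → size ≤ (b * (32 * A) * k) ^ (2 + d + 3)
  size≤power {k} h<k = begin
    size                            ≤⟨ size≤ ⟩
    b * scale                      ≡⟨ cong (b *_) scale≡ ⟩
    b * D ^ p                      ≤⟨ *-monoˡ-≤ (D ^ p) (m≤m^1+k b (suc d + 3) 1≤b) ⟩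
    b ^ p * D ^ p                  ≡⟨ ^-distribʳ-* p b D ⟨
    (b * D) ^ p                    ≤⟨ ^-monoˡ-≤ p (*-monoʳ-≤ b D≤) ⟩
    (b * (4 * (k * (8 * A)))) ^ p  ≡⟨ cong (_^ p) (e₁ b k A) ⟩
    (b * (32 * A) * k) ^ p         ∎
    where
    open ≤-Reasoning
    p = 2 + d + 3
    D≤ : D ≤ 4 * (k * (8 * A))
    D≤ = ≤-trans (≤-reflexive (sym 4*h≡D)) (*-monoʳ-≤ 4 (<⇒≤ h<k))
    e₁ : ∀ b k a → b * (4 * (k * (8 * a))) ≡ b * (32 * a) * k
    e₁ = solve-∀

  size-tilde-theta : SizeTildeTheta (2 + d) (b ^ 3 * A) 0 size ∣ terminals ∣
  size-tilde-theta = sizeTildeTheta {2 + d} {D = D} b A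
    (≤-trans size≤ (≤-reflexive (cong (b *_) scale≡))) (≤-trans (≤-reflexive (sym scale≡)) scale≤size)
    (trans ∣terminals∣ sources≡) 1≤A (m≤m*n (b ^ 3) A {{>-nonZero 1≤A}}) (m≤n*m A (b ^ 3) {{>-nonZero 1≤b³}}) (*-mono-≤ 1≤b³ 1≤A)
    where
    1≤b³ : 1 ≤ b ^ 3
    1≤b³ = m^n>0 b {{>-nonZero 1≤b}} 3

  diameter : ∀ {c} → Positive c → c *ℚ ⟦ b * (32 * A) ⟧ ≡ 1ℚ → ∀ H → IsShortcutSet edges H →
    length H ≤ M * size → SourcewiseDiamAtLeast (edges ++ H) terminals (2 + d + 3) ((c ^ℚ (2 + d + 3)) *ℚ ⟦ size ⟧)
  diameter {c} c>0 c*B≡1 H shortcut m≤ =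
    let s , t , s∈ , reach , far = long-distance H shortcut (few m≤)
    in s , t , s∈ , reach ,
       λ k walk → scaled-bound {c} {b * (32 * A)} {size} {k} (2 + d + 3) (ℚ.pos⇒nonNeg c {{c>0}}) c*B≡1 (size≤power {k} (far k walk))

-- The constants of the theorem

reciprocal : ∀ n .{{_ : NonZero n}} → Σ[ q ∈ ℚ ] Positive q × q *ℚ ⟦ n ⟧ ≡ 1ℚ
reciprocal n = 1/ ⟦ n ⟧ , ℚ.1/pos⇒pos ⟦ n ⟧ , ℚ.*-inverseˡ ⟦ n ⟧
  where
  instance
    ⟦n⟧>0 : Positive ⟦ n ⟧
    ⟦n⟧>0 = ℚ.normalize-pos n 1
    ⟦n⟧≢0 : NonZeroℚ ⟦ n ⟧
    ⟦n⟧≢0 = ℚ.pos⇒nonZero ⟦ n ⟧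

-- Kept for a variable b: with the literal 41 the type checker would unfold the constants.
lower-bound : ∀ b → 41 ≤ b → ∀ (d : ℕ) (C : ℚ) → Positive C →
    Σ[ c ∈ ℚ ] Positive c × (Σ[ K ∈ ℕ ] Σ[ k ∈ ℕ ] 1 ≤ K ×
    (∀ (N : ℕ) → Σ[ n ∈ ℕ ] (N ≤ n) × (1 ≤ n) ×
    (Σ[ E ∈ EdgeList n ] Σ[ S ∈ Subset n ]
    IsDigraph E ×
    SizeTildeTheta (2 + d) K k n ∣ S ∣ ×
    (∀ (H : EdgeList n) → IsShortcutSet E H →
    ⟦ length H ⟧ ≤ℚ C *ℚ ⟦ n ⟧ →
    SourcewiseDiamAtLeast (E Data.List.++ H) S (2 + d + 3) ((c ^ℚ (2 + d + 3)) *ℚ ⟦ n ⟧)) ×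
    (∀ (H : EdgeList n) → IsShortcutSet E H →
    ⟦ length H ⟧ ≤ℚ C *ℚ ⟦ length E ⟧ →
    SourcewiseDiamAtLeast (E Data.List.++ H) S (2 + d + 3) ((c ^ℚ (2 + d + 3)) *ℚ ⟦ n ⟧)))))
lower-bound b 41≤b d C C>0 =
  c , c>0 , b ^ 3 * A₀ , 0 , *-mono-≤ (m^n>0 b 3) (m^n>0 2 (M * (b * 576))) , λ N →
    let open Instance b 41≤b d M N
        open Network e A σ h Q 1≤A A*σ≡D 4*h≡D
    in size , N≤size , ≤-trans 1≤scale scale≤size , edges , terminals , edges-isDigraph , size-tilde-theta
     , (λ H shortcut m≤ → diameter {c} c>0 c*B≡1 H shortcut
         (≤-trans (≤-scaled {C} C>0 m≤) (*-monoˡ-≤ size (m≤n*m c₀ 5))))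
     , (λ H shortcut m≤ → diameter {c} c>0 c*B≡1 H shortcut
         (≤-trans (≤-scaled {C} C>0 m≤) (≤-trans (*-monoʳ-≤ c₀ length-edges≤)
           (≤-reflexive (trans (sym (*-assoc c₀ 5 size)) (cong (_* size) (*-comm c₀ 5)))))))
  where
  c₀ = ∣ ↥ C ∣ℤ
  -- The factor 5 serves both bounds on the shortcut set at once. `A₀` and `B` depend on `b` and `C`
  -- alone, so `c` does not vary with `N`.
  M = 5 * c₀
  A₀ = 2 ^ (M * (b * 576))
  B = b * (32 * A₀)
  instance
    b≢0 : NonZero b
    b≢0 = >-nonZero (≤-trans (s≤s z≤n) 41≤b)
    B≢0 : NonZero B
    B≢0 = m*n≢0 b (32 * A₀) {{b≢0}} {{m*n≢0 32 A₀ {{_}} {{m^n≢0 2 (M * (b * 576))}}}}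
  inverse = reciprocal B
  c = proj₁ inverse
  c>0 = proj₁ (proj₂ inverse)
  c*B≡1 = proj₂ (proj₂ inverse)

theorem6p1 : ∀ (d : ℕ) → 2 ≤ d →
    ∀ (C : ℚ) → Positive C →
    Σ[ c ∈ ℚ ] Positive c × (Σ[ K ∈ ℕ ] Σ[ k ∈ ℕ ] 1 ≤ K ×
    (∀ (N : ℕ) → Σ[ n ∈ ℕ ] (N ≤ n) × (1 ≤ n) ×
    (Σ[ E ∈ EdgeList n ] Σ[ S ∈ Subset n ]
    IsDigraph E ×
    SizeTildeTheta d K k n ∣ S ∣ ×
    (∀ (H : EdgeList n) → IsShortcutSet E H →
    ⟦ length H ⟧ ≤ℚ C *ℚ ⟦ n ⟧ →
    SourcewiseDiamAtLeast (E Data.List.++ H) S (d + 3) ((c ^ℚ (d + 3)) *ℚ ⟦ n ⟧)) ×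
    (∀ (H : EdgeList n) → IsShortcutSet E H →
    ⟦ length H ⟧ ≤ℚ C *ℚ ⟦ length E ⟧ →
    SourcewiseDiamAtLeast (E Data.List.++ H) S (d + 3) ((c ^ℚ (d + 3)) *ℚ ⟦ n ⟧)))))
theorem6p1 (suc (suc d)) (s≤s (s≤s z≤n)) = lower-bound 41 ≤-refl d
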